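{- Let $q$ be an odd prime power, $d\ge2$, $Q$ a nondegenerate quadratic form on $\mathbb F_q^d$, $P\subseteq\mathbb F_q^d$ nonempty and $\mathcal S$ a nonempty family of distinct $Q$-spheres. Let $\mu=1-\frac{I(P,\mathcal S)}{|P||\mathcal S|}$. Then $$\mu\le\operatorname{dist}_{\mathrm{lin}}(P,\mathcal S).$$ If $\mu<(d+1)/(d+2)^2$, then $$\operatorname{dist}_{\mathrm{lin}}(P,\mathcal S)\le2\sqrt{(d+1)\mu}.$$ Moreover, if $\eta$ is a real number with $$\sigma(P,\mathcal S)\ge(1-\eta)(1-q^{ -1})|P||\mathcal S|,$$ then $\mu\le\eta(1-q^{ -1})$, and whenever $0<\eta(1-q^{ -1})<\frac{d+1}{(d+2)^2}$, $$\operatorname{dist}_{\mathrm{lin}}(P,\mathcal S)\le2\sqrt{(d+1)\eta(1-q^{ -1})}.$$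
   Context: Put $\langle x,y\rangle_Q=\frac{Q(x+y)-Q(x)-Q(y)}2$. For $c\in\mathbb F_q^d$, $r\in\mathbb F_q$ the $Q$-sphere is $S_Q(c,r)=\{x\in\mathbb F_q^d:Q(x-c)=r\}$; spheres are parametrized by pairs $(c,r)$ and distinct spheres means distinct parameter pairs. $I(P,\mathcal S)=|\{(p,S)\in P\times\mathcal S:p\in S\}|$ and $\sigma(P,\mathcal S)=I(P,\mathcal S)-|P||\mathcal S|/q$. The lift is $\Phi(S_Q(c,r))=(2c,r-Q(c))\in\mathbb F_q^{d+1}$. For $x\in\mathbb F_q^d$, $y=(u,a)\in\mathbb F_q^d\times\mathbb F_q$ put $\Lambda_x(y)=Q(x)-\langle x,u\rangle_Q-a$. For a (nonempty) affine subspace $L\subseteq\mathbb F_q^{d+1}$ put $\mathcal S(L)=\Phi^{ -1}(L)$ and $B(L)=\{x\in\mathbb F_q^d:\Lambda_x(y)=0\ \forall y\in L\}$. The distance from a lifted-linear model is $$\operatorname{dist}_{\mathrm{lin}}(P,\mathcal S)=\inf_{L:\,B(L)\ne\varnothing}\left(\frac{|P\setminus B(L)|}{|P|}+\frac{|\mathcal S\setminus\mathcal S(L)|}{|\mathcal S|}\right),$$ the infimum being over affine subspaces $L\subseteq\mathbb F_q^{d+1}$ with $B(L)\neq\varnothing$. -}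

module Defs where

open import Algebra.Structures using (IsCommutativeRing)
open import Data.Empty using (⊥-elim)
open import Data.Fin using (Fin)
import Data.Fin.Properties as Fin
open import Data.Integer using (+_)
import Data.Integer as ℤ
open import Data.List using (List; []; _∷_; _++_; map; filter; length; allFin; cartesianProduct; cartesianProductWith)
open import Data.List.Membership.Propositional using (_∈_; find; lose)
open import Data.List.Membership.Propositional.Properties
  using (∈-map⁺; ∈-allFin; ∈-cartesianProduct⁺; ∈-cartesianProductWith⁺; ∈-++⁺ˡ; ∈-++⁺ʳ; ∈-filter⁺; ∈-filter⁻)
import Data.List.Membership.DecPropositional as DecMembership
open import Data.List.Properties using (filter-≐)
open import Data.List.Relation.Unary.All as All using (All)
open import Data.List.Relation.Unary.Any as Any using (Any; here; there)
open import Data.List.Relation.Unary.Unique.Propositional using (Unique)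
open import Data.Nat as ℕ using (ℕ; zero; suc)
import Data.Nat.Properties as ℕ
open import Data.Nat.Divisibility using (_∣_)
open import Data.Nat.Primality using (Prime)
open import Data.Product using (Σ; ∃; ∃-syntax; _×_; _,_; proj₁; proj₂)
open import Data.Product.Properties using (≡-dec)
open import Data.Rational as ℚ
  using (ℚ; 0ℚ; 1ℚ; Positive; _+_; _*_; _-_; -_; _/_; _<_; _≤_; 1/_)
import Data.Rational.Properties as ℚ
open import Data.Rational.Unnormalised using (mkℚᵘ; *<*)
import Data.Rational.Unnormalised.Properties as ℚᵘ
open import Data.Rational.Solver using (module +-*-Solver)
open import Data.Sum using (_⊎_; inj₁; inj₂)
open import Data.Vec as Vec using (Vec; []; _∷_; zipWith)
import Data.Vec.Properties as Vec
open import Function using (_∘_; case_of_)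
open import Function.Bundles using (_↔_; _⇔_; mk⇔; Inverse; Equivalence)
open import Function.Properties.Inverse using (↔⇒↣)
open import Relation.Binary.Definitions using (DecidableEquality; Tri; tri<; tri≈; tri>)
open import Relation.Binary.PropositionalEquality
open import Relation.Nullary using (¬_; Dec; yes; no; ¬?)
open import Relation.Nullary.Decidable using (map′; _×-dec_)

------------------------------------------------------------------------
-- Real numbers as two-sided Dedekind cuts of rationals.

record ℝ : Set₁ where
  field
    lower upper     : ℚ → Set
    lower-inhabited : ∃ lower
    upper-inhabited : ∃ upper
    lower-rounded   : ∀ r → lower r ⇔ (∃[ s ] r < s × lower s)
    upper-rounded   : ∀ r → upper r ⇔ (∃[ s ] s < r × upper s)
    disjoint        : ∀ r → ¬ (lower r × upper r)
    located         : ∀ {r s} → r < s → lower r ⊎ upper s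

open ℝ public

infix 4 _≤ℝ_ _<ℝ_

_≤ℝ_ : ℝ → ℝ → Set
x ≤ℝ y = ∀ r → lower x r → lower y r

_<ℝ_ : ℝ → ℝ → Set
x <ℝ y = ∃[ r ] upper x r × lower y r

lower-open : ∀ x {r} → lower x r → ∃[ s ] r < s × lower x s
lower-open x {r} = Equivalence.to (lower-rounded x r)

lower-down : ∀ x {r s} → r < s → lower x s → lower x r
lower-down x {r} {s} r<s l = Equivalence.from (lower-rounded x r) (s , r<s , l)

upper-open : ∀ x {r} → upper x r → ∃[ s ] s < r × upper x s
upper-open x {r} = Equivalence.to (upper-rounded x r)

upper-up : ∀ x {r s} → s < r → upper x s → upper x r
upper-up x {r} {s} s<r u = Equivalence.from (upper-rounded x r) (s , s<r , u)

p-1<p : ∀ p → p - 1ℚ < p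
p-1<p p = subst (p - 1ℚ <_) (ℚ.+-identityʳ p) (ℚ.+-monoʳ-< p (ℚ.negative⁻¹ (- 1ℚ)))

p<p+1 : ∀ p → p < p + 1ℚ
p<p+1 p = subst (_< p + 1ℚ) (ℚ.+-identityʳ p) (ℚ.+-monoʳ-< p (ℚ.positive⁻¹ 1ℚ))

fromℚ : ℚ → ℝ
fromℚ p = record
  { lower           = _< p
  ; upper           = p <_
  ; lower-inhabited = p - 1ℚ , p-1<p p
  ; upper-inhabited = p + 1ℚ , p<p+1 p
  ; lower-rounded   = λ r → mk⇔ ℚ.<-dense (λ (_ , r<s , s<p) → ℚ.<-trans r<s s<p)
  ; upper-rounded   = λ r → mk⇔ (λ p<r → let s , p<s , s<r = ℚ.<-dense p<r in s , s<r , p<s)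
                               (λ (_ , s<r , p<s) → ℚ.<-trans p<s s<r)
  ; disjoint        = λ r (r<p , p<r) → ℚ.<-asym r<p p<r
  ; located         = loc
  }
  where
  loc : ∀ {r s} → r < s → (r < p) ⊎ (p < s)
  loc {r} {s} r<s with r ℚ.<? p
  ... | yes r<p = inj₁ r<p
  ... | no  r≮p = inj₂ (ℚ.≤-<-trans (ℚ.≮⇒≥ r≮p) r<s)

-- p ⊖ x is the real number p - x, and c ⊙ x and n · x are products, for positive
-- rational c and positive natural n.
infixl 6 _⊖_

_⊖_ : ℚ → ℝ → ℝ
p ⊖ x = record
  { lower           = λ r → upper x (p - r)
  ; upper           = λ r → lower x (p - r)
  ; lower-inhabited = let u , ux = upper-inhabited x in p - u , subst (upper x) (flip² u) ux
  ; upper-inhabited = let l , lx = lower-inhabited x in p - l , subst (lower x) (flip² l) lx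
  ; lower-rounded   = λ r → mk⇔
      (λ u → let s , s<p-r , us = upper-open x u in
        p - s , swapʳ s<p-r , subst (upper x) (flip² s) us)
      (λ (s , r<s , us) → upper-up x (anti r<s) us)
  ; upper-rounded   = λ r → mk⇔
      (λ l → let s , p-r<s , ls = lower-open x l in
        p - s , swapˡ p-r<s , subst (lower x) (flip² s) ls)
      (λ (s , s<r , ls) → lower-down x (anti s<r) ls)
  ; disjoint        = λ r (u , l) → disjoint x (p - r) (l , u)
  ; located         = λ r<s → case located x (anti r<s) of λ where
      (inj₁ l) → inj₂ l
      (inj₂ u) → inj₁ u
  }
  where
  open +-*-Solver
  flip² : ∀ r → r ≡ p - (p - r)
  flip² r = solve 2 (λ p r → r := p :- (p :- r)) refl p r
  anti : ∀ {r s} → r < s → p - s < p - r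
  anti r<s = ℚ.+-monoʳ-< p (ℚ.neg-antimono-< r<s)
  swapʳ : ∀ {r s} → s < p - r → r < p - s
  swapʳ {r} s<p-r = subst (_< _) (sym (flip² r)) (anti s<p-r)
  swapˡ : ∀ {r s} → p - r < s → p - s < r
  swapˡ {r} p-r<s = subst (_ <_) (sym (flip² r)) (anti p-r<s)

infixr 7 _⊙_ _·_

_⊙_ : (c : ℚ) .{{_ : Positive c}} → ℝ → ℝ
c ⊙ x = record
  { lower           = λ r → lower x (r * c⁻¹)
  ; upper           = λ r → upper x (r * c⁻¹)
  ; lower-inhabited = let l , lx = lower-inhabited x in l * c , subst (lower x) (cancel l) lx
  ; upper-inhabited = let u , ux = upper-inhabited x in u * c , subst (upper x) (cancel u) ux
  ; lower-rounded   = λ r → mk⇔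
      (λ l → let s , r/c<s , ls = lower-open x l in
        s * c , subst (_< s * c) (cancel′ r) (ℚ.*-monoˡ-<-pos c r/c<s) , subst (lower x) (cancel s) ls)
      (λ (s , r<s , ls) → lower-down x (mono r<s) ls)
  ; upper-rounded   = λ r → mk⇔
      (λ u → let s , s<r/c , us = upper-open x u in
        s * c , subst (s * c <_) (cancel′ r) (ℚ.*-monoˡ-<-pos c s<r/c) , subst (upper x) (cancel s) us)
      (λ (s , s<r , us) → upper-up x (mono s<r) us)
  ; disjoint        = λ r → disjoint x (r * c⁻¹)
  ; located         = λ r<s → located x (mono r<s)
  }
  where
  c⁻¹ : ℚ
  c⁻¹ = (1/ c) {{ℚ.pos⇒nonZero c}}
  cancel : ∀ r → r ≡ (r * c) * c⁻¹
  cancel r = sym (trans (ℚ.*-assoc r c c⁻¹)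
    (trans (cong (r *_) (ℚ.*-inverseʳ c {{ℚ.pos⇒nonZero c}})) (ℚ.*-identityʳ r)))
  cancel′ : ∀ r → (r * c⁻¹) * c ≡ r
  cancel′ r = trans (ℚ.*-assoc r c⁻¹ c)
    (trans (cong (r *_) (ℚ.*-inverseˡ c {{ℚ.pos⇒nonZero c}})) (ℚ.*-identityʳ r))
  mono : ∀ {r s} → r < s → r * c⁻¹ < s * c⁻¹
  mono = ℚ.*-monoˡ-<-pos c⁻¹ {{ℚ.1/pos⇒pos c}}

_·_ : (n : ℕ) .{{_ : ℕ.NonZero n}} → ℝ → ℝ
n · x = _⊙_ (+ n / 1) {{ℚ.normalize-pos n 1}} x

private
  pos* : ∀ {p q} → 0ℚ < p → 0ℚ < q → 0ℚ < p * q
  pos* {p} {q} 0<p 0<q =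
    ℚ.positive⁻¹ (p * q) {{ℚ.pos*pos⇒pos p {{ℚ.positive 0<p}} q {{ℚ.positive 0<q}}}}

  sq-mono : ∀ {r s} → 0ℚ ≤ r → r < s → r * r < s * s
  sq-mono {r} {s} 0≤r r<s = ℚ.≤-<-trans
    (ℚ.*-monoˡ-≤-nonNeg r {{ℚ.nonNegative 0≤r}} (ℚ.<⇒≤ r<s))
    (ℚ.*-monoˡ-<-pos s {{ℚ.positive (ℚ.≤-<-trans 0≤r r<s)}} r<s)

  0<diff : ∀ {p q} → p < q → 0ℚ < q - p
  0<diff {p} {q} p<q = subst (_< q - p) (ℚ.+-inverseʳ p) (ℚ.+-monoˡ-< (- p) p<q)

  diff<0 : ∀ {p q} → 0ℚ < q - p → p < q
  diff<0 {p} {q} h = subst₂ _<_ (ℚ.+-identityʳ p) (solve 2 (λ p q → p :+ (q :- p) := q) refl p q)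
    (ℚ.+-monoʳ-< p h)
    where open +-*-Solver

  -- s = r + ε with ε = δ / (2r + 1 + δ) and δ = p - r².
  sq-above : ∀ {r p} → 0ℚ ≤ r → r * r < p → ∃[ s ] r < s × s * s < p
  sq-above {r} {p} 0≤r r²<p = r + ε , r<r+ε , diff<0 (subst (0ℚ <_) (sym gap) 0<gap)
    where
    open +-*-Solver
    δ = p - r * r
    0<δ = 0<diff r²<p
    m = (r + r) + 1ℚ
    0<m : 0ℚ < m
    0<m = ℚ.+-mono-≤-< (ℚ.+-mono-≤ 0≤r 0≤r) (ℚ.positive⁻¹ 1ℚ)
    D = m + δ
    0<D : 0ℚ < D
    0<D = ℚ.+-mono-< 0<m 0<δ
    instance
      D-pos = ℚ.positive 0<D
      D≢0   = ℚ.pos⇒nonZero D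
    i = 1/ D
    0<i : 0ℚ < i
    0<i = ℚ.positive⁻¹ i {{ℚ.1/pos⇒pos D}}
    ε = δ * i
    0<ε : 0ℚ < ε
    0<ε = pos* 0<δ 0<i
    r<r+ε : r < r + ε
    r<r+ε = subst (_< r + ε) (ℚ.+-identityʳ r) (ℚ.+-monoʳ-< r 0<ε)
    -- 1 - ε = m * i and δ = ε * D
    eq₁ : m * i ≡ 1ℚ - ε
    eq₁ = trans (solve 3 (λ m d i → m :* i := (m :+ d) :* i :- d :* i) refl m δ i)
      (cong (_- ε) (ℚ.*-inverseʳ D))
    eq₂ : δ ≡ ε * D
    eq₂ = sym (trans (ℚ.*-assoc δ i D) (trans (cong (δ *_) (ℚ.*-inverseˡ D)) (ℚ.*-identityʳ δ)))
    gap : p - (r + ε) * (r + ε) ≡ ε * (m * i + δ)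
    gap = begin
      p - (r + ε) * (r + ε)
        ≡⟨ solve 3 (λ p r e → p :- (r :+ e) :* (r :+ e) := (p :- r :* r) :- e :* ((r :+ r) :+ e)) refl p r ε ⟩
      δ - ε * ((r + r) + ε)
        ≡⟨ cong (_- ε * ((r + r) + ε)) eq₂ ⟩
      ε * D - ε * ((r + r) + ε)
        ≡⟨ solve 4 (λ e r d o → e :* (((r :+ r) :+ o) :+ d) :- e :* ((r :+ r) :+ e) := e :* ((o :- e) :+ d)) refl ε r δ 1ℚ ⟩
      ε * ((1ℚ - ε) + δ)
        ≡⟨ cong (λ z → ε * (z + δ)) (sym eq₁) ⟩
      ε * (m * i + δ) ∎
      where open ≡-Reasoning
    0<gap : 0ℚ < ε * (m * i + δ)
    0<gap = pos* 0<ε (ℚ.+-mono-< (pos* 0<m 0<i) 0<δ)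

  -- s = r - ε with ε = r δ / (2r² + δ) and δ = r² - p.
  sq-below : ∀ {r p} → 0ℚ < r → p < r * r → ∃[ s ] s < r × 0ℚ < s × p < s * s
  sq-below {r} {p} 0<r p<r² = s , s<r , 0<s , diff<0 (subst (0ℚ <_) (sym gap) 0<gap)
    where
    open +-*-Solver
    δ = r * r - p
    0<δ = 0<diff p<r²
    a = r * r
    0<a : 0ℚ < a
    0<a = pos* 0<r 0<r
    D = (a + a) + δ
    0<D : 0ℚ < D
    0<D = ℚ.+-mono-< (ℚ.+-mono-< 0<a 0<a) 0<δ
    instance
      D-pos = ℚ.positive 0<D
      D≢0   = ℚ.pos⇒nonZero D
    i = 1/ D
    0<i : 0ℚ < i
    0<i = ℚ.positive⁻¹ i {{ℚ.1/pos⇒pos D}}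
    k = δ * i
    0<k : 0ℚ < k
    0<k = pos* 0<δ 0<i
    s = r * ((a + a) * i)
    0<s : 0ℚ < s
    0<s = pos* 0<r (pos* (ℚ.+-mono-< 0<a 0<a) 0<i)
    eq₁ : (a + a) * i ≡ 1ℚ - k
    eq₁ = trans (solve 3 (λ m d i → m :* i := (m :+ d) :* i :- d :* i) refl (a + a) δ i)
      (cong (_- k) (ℚ.*-inverseʳ D))
    s≡ : s ≡ r - r * k
    s≡ = trans (cong (r *_) eq₁)
      (trans (solve 3 (λ r o k → r :* (o :- k) := r :* o :- r :* k) refl r 1ℚ k)
        (cong (λ z → z - r * k) (ℚ.*-identityʳ r)))
    s<r : s < r
    s<r = diff<0 (subst (0ℚ <_)
      (trans (solve 2 (λ r x → x := r :- (r :- x)) refl r (r * k)) (cong (λ z → r - z) (sym s≡)))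
      (pos* 0<r 0<k))
    eq₂ : δ ≡ k * D
    eq₂ = sym (trans (ℚ.*-assoc δ i D) (trans (cong (δ *_) (ℚ.*-inverseˡ D)) (ℚ.*-identityʳ δ)))
    gap : s * s - p ≡ k * δ + a * (k * k)
    gap = begin
      s * s - p
        ≡⟨ cong (λ z → z * z - p) s≡ ⟩
      (r - r * k) * (r - r * k) - p
        ≡⟨ solve 3 (λ r k p → (r :- r :* k) :* (r :- r :* k) :- p
             := (r :* r :- p) :+ (r :* r :* (k :* k) :- k :* (r :* r :+ r :* r))) refl r k p ⟩
      δ + (a * (k * k) - k * (a + a))
        ≡⟨ cong (_+ (a * (k * k) - k * (a + a))) eq₂ ⟩
      k * D + (a * (k * k) - k * (a + a))
        ≡⟨ solve 3 (λ k a d → k :* ((a :+ a) :+ d) :+ (a :* (k :* k) :- k :* (a :+ a))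
             := k :* d :+ a :* (k :* k)) refl k a δ ⟩
      k * δ + a * (k * k) ∎
      where open ≡-Reasoning
    0<gap : 0ℚ < k * δ + a * (k * k)
    0<gap = ℚ.+-mono-< (pos* 0<k 0<δ) (pos* 0<a (pos* 0<k 0<k))

-- The cut of √(max(x,0)); it agrees with the usual square root for x ≥ 0.
√_ : ℝ → ℝ
√ x = record
  { lower           = λ r → r < 0ℚ ⊎ lower x (r * r)
  ; upper           = λ r → 0ℚ < r × upper x (r * r)
  ; lower-inhabited = - 1ℚ , inj₁ (ℚ.negative⁻¹ (- 1ℚ))
  ; upper-inhabited = up
  ; lower-rounded   = λ r → mk⇔ open↓ (λ (s , r<s , ls) → close↓ r<s ls)
  ; upper-rounded   = λ r → mk⇔
      (λ (0<r , u) → let p , p<r² , up = upper-open x u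
                         s , s<r , 0<s , p<s² = sq-below 0<r p<r²
                     in s , s<r , 0<s , upper-up x p<s² up)
      (λ (s , s<r , 0<s , us) → ℚ.<-trans 0<s s<r , upper-up x (sq-mono (ℚ.<⇒≤ 0<s) s<r) us)
  ; disjoint        = λ where
      r (inj₁ r<0 , 0<r , _) → ℚ.<-asym r<0 0<r
      r (inj₂ l   , _   , u) → disjoint x (r * r) (l , u)
  ; located         = loc
  }
  where
  up : ∃[ r ] 0ℚ < r × upper x (r * r)
  up with upper-inhabited x
  ... | u , ux with u ℚ.≤? 1ℚ
  ...   | yes u≤1 = (1ℚ + 1ℚ) , ℚ.positive⁻¹ (1ℚ + 1ℚ) ,
                    upper-up x (ℚ.≤-<-trans u≤1 (sq-mono {1ℚ} (ℚ.<⇒≤ (ℚ.positive⁻¹ 1ℚ)) (p<p+1 1ℚ))) ux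
  ...   | no  u≰1 = u , 0<u , upper-up x (subst (_< u * u) (ℚ.*-identityˡ u)
                      (ℚ.*-monoˡ-<-pos u {{ℚ.positive 0<u}} 1<u)) ux
    where
    1<u = ℚ.≰⇒> u≰1
    0<u = ℚ.<-trans (ℚ.positive⁻¹ 1ℚ) 1<u
  open↓ : ∀ {r} → r < 0ℚ ⊎ lower x (r * r) → ∃[ s ] r < s × (s < 0ℚ ⊎ lower x (s * s))
  open↓ {r} h with r ℚ.<? 0ℚ | h
  ... | yes r<0 | _        = let s , r<s , s<0 = ℚ.<-dense r<0 in s , r<s , inj₁ s<0
  ... | no  r≮0 | inj₁ r<0 = ⊥-elim (r≮0 r<0)
  ... | no  r≮0 | inj₂ l   =
    let p , r²<p , lp = lower-open x l
        s , r<s , s²<p = sq-above (ℚ.≮⇒≥ r≮0) r²<p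
    in s , r<s , inj₂ (lower-down x s²<p lp)
  close↓ : ∀ {r s} → r < s → s < 0ℚ ⊎ lower x (s * s) → r < 0ℚ ⊎ lower x (r * r)
  close↓ {r} r<s (inj₁ s<0) = inj₁ (ℚ.<-trans r<s s<0)
  close↓ {r} r<s (inj₂ l) with r ℚ.<? 0ℚ
  ... | yes r<0 = inj₁ r<0
  ... | no  r≮0 = inj₂ (lower-down x (sq-mono (ℚ.≮⇒≥ r≮0) r<s) l)
  loc : ∀ {r s} → r < s → (r < 0ℚ ⊎ lower x (r * r)) ⊎ (0ℚ < s × upper x (s * s))
  loc {r} {s} r<s with r ℚ.<? 0ℚ
  ... | yes r<0 = inj₁ (inj₁ r<0)
  ... | no  r≮0 with located x (sq-mono (ℚ.≮⇒≥ r≮0) r<s)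
  ...   | inj₁ l = inj₁ (inj₂ l)
  ...   | inj₂ u = inj₂ (ℚ.≤-<-trans (ℚ.≮⇒≥ r≮0) r<s , u)

-- The infimum of a nonempty family of rationals bounded below by b.  The last
-- argument supplies locatedness, which is not automatic constructively.
infimum : {I : Set} (f : I → ℚ) → I → (b : ℚ) → (∀ i → b ≤ f i) →
          (∀ s → Dec (∃[ i ] f i < s)) → ℝ
infimum f i₀ b b≤f f<? = record
  { lower           = λ r → ∃[ s ] r < s × (∀ i → s ≤ f i)
  ; upper           = λ r → ∃[ i ] f i < r
  ; lower-inhabited = b - 1ℚ , b , p-1<p b , b≤f
  ; upper-inhabited = f i₀ + 1ℚ , i₀ , p<p+1 (f i₀)
  ; lower-rounded   = λ r → mk⇔
      (λ (s , r<s , s≤f) → let t , r<t , t<s = ℚ.<-dense r<s in t , r<t , s , t<s , s≤f)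
      (λ (t , r<t , s , t<s , s≤f) → s , ℚ.<-trans r<t t<s , s≤f)
  ; upper-rounded   = λ r → mk⇔
      (λ (i , fi<r) → let t , fi<t , t<r = ℚ.<-dense fi<r in t , t<r , i , fi<t)
      (λ (t , t<r , i , fi<t) → i , ℚ.<-trans fi<t t<r)
  ; disjoint        = λ r ((s , r<s , s≤f) , i , fi<r) →
      ℚ.<-irrefl refl (ℚ.<-≤-trans (ℚ.<-trans fi<r r<s) (s≤f i))
  ; located         = λ {r} {s} r<s → case f<? s of λ where
      (yes fi<s)  → inj₂ fi<s
      (no  ∄fi<s) → inj₁ (s , r<s , λ i → ℚ.≮⇒≥ (λ fi<s → ∄fi<s (i , fi<s)))
  }

------------------------------------------------------------------------
-- Finite sets

record FinSet (A : Set) : Set where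
  field
    elements : List A
    unique   : Unique elements

open FinSet public

∣_∣ : {A : Set} → FinSet A → ℕ
∣ X ∣ = length (elements X)

private
  sublists : {A : Set} → List A → List (List A)
  sublists []       = [] ∷ []
  sublists (x ∷ xs) = map (x ∷_) (sublists xs) ++ sublists xs

  filter-∈-sublists : {A : Set} {P : A → Set} (P? : ∀ x → Dec (P x)) (xs : List A) →
                      filter P? xs ∈ sublists xs
  filter-∈-sublists P? []       = here refl
  filter-∈-sublists P? (x ∷ xs) with P? x
  ... | yes _ = ∈-++⁺ˡ (∈-map⁺ (x ∷_) (filter-∈-sublists P? xs))
  ... | no  _ = ∈-++⁺ʳ (map (x ∷_) (sublists xs)) (filter-∈-sublists P? xs)

------------------------------------------------------------------------
-- Finite fields and quadratic forms

OddPrimePower : ℕ → Set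
OddPrimePower q = ¬ (2 ∣ q) × ∃[ p ] ∃[ k ] Prime p × 1 ℕ.≤ k × q ≡ p ℕ.^ k

-- A field with exactly q elements; x ⁻¹ is unconstrained at x = 0.
record FiniteField (q : ℕ) : Set₁ where
  infixl 6 _⊕_ _⊝_
  infixl 7 _⊗_
  field
    Carrier           : Set
    _⊕_ _⊗_           : Carrier → Carrier → Carrier
    ⊝_                : Carrier → Carrier
    0# 1#             : Carrier
    _⁻¹               : Carrier → Carrier
    isCommutativeRing : IsCommutativeRing _≡_ _⊕_ _⊗_ ⊝_ 0# 1#
    0≢1               : 0# ≢ 1#
    ⁻¹-inverseʳ       : ∀ x → x ≢ 0# → x ⊗ x ⁻¹ ≡ 1#
    finite            : Carrier ↔ Fin q

  _⊝_ : Carrier → Carrier → Carrier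
  x ⊝ y = x ⊕ (⊝ y)

  half : Carrier → Carrier
  half x = x ⊗ (1# ⊕ 1#) ⁻¹

  _≟_ : DecidableEquality Carrier
  _≟_ = Fin.inj⇒≟ (↔⇒↣ finite)

  all : List Carrier
  all = map (Inverse.from finite) (allFin q)

  ∈-all : ∀ x → x ∈ all
  ∈-all x = subst (_∈ all) (Inverse.strictlyInverseʳ finite x)
    (∈-map⁺ (Inverse.from finite) (∈-allFin (Inverse.to finite x)))

  instance
    q-nonZero : ℕ.NonZero q
    q-nonZero = Fin.nonZeroIndex (Inverse.to finite 0#)

  1<q : 1 ℕ.< q
  1<q with 1 ℕ.<? q
  ... | yes 1<q = 1<q
  ... | no  1≮q = ⊥-elim (0≢1 (trans (sym (Inverse.strictlyInverseʳ finite 0#))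
      (trans (cong (Inverse.from finite) (subsingleton (ℕ.≮⇒≥ 1≮q) _ _)) (Inverse.strictlyInverseʳ finite 1#))))
    where
    subsingleton : ∀ {n} → n ℕ.≤ 1 → (i j : Fin n) → i ≡ j
    subsingleton {suc zero} _ Fin.zero Fin.zero = refl
    subsingleton {suc (suc _)} (ℕ.s≤s ()) _ _

module _ {q : ℕ} (𝔽 : FiniteField q) where
  open FiniteField 𝔽

  Vector : ℕ → Set
  Vector d = Vec Carrier d

  module _ {d : ℕ} where
    infixl 6 _+ᵥ_ _-ᵥ_
    infixl 7 _*ᵥ_

    0ᵥ : Vector d
    0ᵥ = Vec.replicate d 0#

    _+ᵥ_ _-ᵥ_ : Vector d → Vector d → Vector d
    _+ᵥ_ = zipWith _⊕_
    _-ᵥ_ = zipWith _⊝_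

    _*ᵥ_ : Carrier → Vector d → Vector d
    t *ᵥ x = Vec.map (t ⊗_) x

    polar : (Vector d → Carrier) → Vector d → Vector d → Carrier
    polar Q x y = (Q (x +ᵥ y) ⊝ Q x) ⊝ Q y

  -- Linearity of the polar form in its second argument follows by symmetry.
  record QuadraticForm (d : ℕ) : Set where
    field
      form        : Vector d → Carrier
      homogeneous : ∀ t x → form (t *ᵥ x) ≡ (t ⊗ t) ⊗ form x
      polar-+     : ∀ x y z → polar form (x +ᵥ y) z ≡ polar form x z ⊕ polar form y z
      polar-*     : ∀ t x z → polar form (t *ᵥ x) z ≡ t ⊗ polar form x z

    ⟨_,_⟩ : Vector d → Vector d → Carrier
    ⟨ x , y ⟩ = half (polar form x y)

    Nondegenerate : Set
    Nondegenerate = ∀ x → (∀ y → ⟨ x , y ⟩ ≡ 0#) → x ≡ 0ᵥ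

  allVectors : ∀ d → List (Vector d)
  allVectors zero    = [] ∷ []
  allVectors (suc d) = cartesianProductWith _∷_ all (allVectors d)

  ∈-allVectors : ∀ {d} (x : Vector d) → x ∈ allVectors d
  ∈-allVectors []      = here refl
  ∈-allVectors (a ∷ x) = ∈-cartesianProductWith⁺ _∷_ (∈-all a) (∈-allVectors x)

------------------------------------------------------------------------
-- Spheres, incidences and lifted-linear models

module Spheres {q d : ℕ} (𝔽 : FiniteField q) (𝑸 : QuadraticForm 𝔽 d) where
  open FiniteField 𝔽
  open QuadraticForm 𝑸 renaming (form to Q)

  V : Set
  V = Vector 𝔽 d

  infixl 6 _+ₚ_ _-ₚ_
  infixl 7 _*ₚ_
  infix 4 _∈ₛ_ _∈B_ _∈𝒮_

  _≟ᵥ_ : DecidableEquality V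
  _≟ᵥ_ = Vec.≡-dec _≟_

  -- A sphere is its parameter pair (c , r).
  Sphere : Set
  Sphere = V × Carrier

  _∈ₛ_ : V → Sphere → Set
  x ∈ₛ (c , r) = Q (_-ᵥ_ 𝔽 x c) ≡ r

  _∈ₛ?_ : ∀ x S → Dec (x ∈ₛ S)
  x ∈ₛ? (c , r) = Q (_-ᵥ_ 𝔽 x c) ≟ r

  incidences : FinSet V → FinSet Sphere → ℕ
  incidences P 𝒮 = length (filter (λ (x , S) → x ∈ₛ? S)
                                  (cartesianProduct (elements P) (elements 𝒮)))

  σ : FinSet V → FinSet Sphere → ℚ
  σ P 𝒮 = (+ incidences P 𝒮 / 1) - (+ (∣ P ∣ ℕ.* ∣ 𝒮 ∣) / q)

  μ : (P : FinSet V) (𝒮 : FinSet Sphere) .{{_ : ℕ.NonZero ∣ P ∣}} .{{_ : ℕ.NonZero ∣ 𝒮 ∣}} → ℚ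
  μ P 𝒮 = 1ℚ - (+ incidences P 𝒮 / (∣ P ∣ ℕ.* ∣ 𝒮 ∣)) {{ℕ.m*n≢0 ∣ P ∣ ∣ 𝒮 ∣}}

  1-q⁻¹ : ℚ
  1-q⁻¹ = 1ℚ - (+ 1 / q)

  instance
    1-q⁻¹-positive : Positive 1-q⁻¹
    1-q⁻¹-positive = ℚ.positive (0<diff (1/n<1 1<q))
      where
      1/n<1 : ∀ {n} .{{_ : ℕ.NonZero n}} → 1 ℕ.< n → + 1 / n < 1ℚ
      1/n<1 {suc n-1} 1<n = ℚ.toℚᵘ-cancel-< (ℚᵘ.<-respˡ-≃
        (ℚᵘ.≃-sym (ℚ.toℚᵘ-fromℚᵘ (mkℚᵘ (+ 1) n-1)))
        (*<* (ℤ.+<+ (subst (1 ℕ.<_) (sym (ℕ.+-identityʳ (suc n-1))) 1<n))))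

  -- 𝔽^{d+1} is presented as 𝔽^d × 𝔽.
  Point : Set
  Point = V × Carrier

  0ₚ : Point
  0ₚ = 0ᵥ 𝔽 , 0#

  _+ₚ_ _-ₚ_ : Point → Point → Point
  (u , a) +ₚ (v , b) = _+ᵥ_ 𝔽 u v , a ⊕ b
  (u , a) -ₚ (v , b) = _-ᵥ_ 𝔽 u v , a ⊝ b

  _*ₚ_ : Carrier → Point → Point
  t *ₚ (u , a) = _*ᵥ_ 𝔽 t u , t ⊗ a

  Φ : Sphere → Point
  Φ (c , r) = _*ᵥ_ 𝔽 (1# ⊕ 1#) c , r ⊝ Q c

  Λ : V → Point → Carrier
  Λ x (u , a) = (Q x ⊝ ⟨ x , u ⟩) ⊝ a

  open DecMembership (≡-dec _≟ᵥ_ _≟_) public using (_∈?_)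

  -- Subsets L of the lifted space are given by lists of their points; only
  -- membership in L is ever used, so order and repetitions are irrelevant.
  record IsAffineSubspace (L : List Point) : Set where
    field
      nonempty : ∃[ y ] y ∈ L
      closed   : ∀ t {y₁ y₂ y₃} → y₁ ∈ L → y₂ ∈ L → y₃ ∈ L → y₁ +ₚ t *ₚ (y₂ -ₚ y₃) ∈ L

  _∈B_ : V → List Point → Set
  x ∈B L = ∀ y → y ∈ L → Λ x y ≡ 0#

  _∈𝒮_ : Sphere → List Point → Set
  S ∈𝒮 L = Φ S ∈ L

  _∈B?_ : ∀ x L → Dec (x ∈B L)
  x ∈B? L = map′ (λ h y → All.lookup h) (λ h → All.tabulate (λ {y} → h y)) (All.all? (λ y → Λ x y ≟ 0#) L)

  _∈𝒮?_ : ∀ S L → Dec (S ∈𝒮 L)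
  S ∈𝒮? L = Φ S ∈? L

  -- The affine subspaces L with B(L) ≠ ∅.
  record LinearModel : Set where
    field
      L          : List Point
      isAffine   : IsAffineSubspace L
      B-nonempty : ∃[ x ] x ∈B L

  private
    affine? : ∀ L → Dec (IsAffineSubspace L)
    affine? L = map′ to from (any? ×-dec closed?)
      where
      Closed = All (λ t → All (λ y₁ → All (λ y₂ → All (λ y₃ → y₁ +ₚ t *ₚ (y₂ -ₚ y₃) ∈ L) L) L) L) all
      closed? : Dec Closed
      closed? = All.all? (λ t → All.all? (λ y₁ → All.all? (λ y₂ → All.all? (λ y₃ →
        (y₁ +ₚ t *ₚ (y₂ -ₚ y₃)) ∈? L) L) L) L) all
      any? : Dec (∃[ y ] y ∈ L)
      any? = nonempty? L
        where
        nonempty? : ∀ L → Dec (∃[ y ] y ∈ L)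
        nonempty? []      = no λ ()
        nonempty? (y ∷ _) = yes (y , here refl)
      to : (∃[ y ] y ∈ L) × Closed → IsAffineSubspace L
      to (ne , cl) = record
        { nonempty = ne
        ; closed   = λ t p₁ p₂ p₃ →
            All.lookup (All.lookup (All.lookup (All.lookup cl (∈-all t)) p₁) p₂) p₃
        }
      from : IsAffineSubspace L → (∃[ y ] y ∈ L) × Closed
      from aff = nonempty , All.tabulate (λ {t} _ → All.tabulate (λ p₁ → All.tabulate (λ p₂ →
        All.tabulate (λ p₃ → closed t p₁ p₂ p₃))))
        where open IsAffineSubspace aff

    B-nonempty? : ∀ L → Dec (∃[ x ] x ∈B L)
    B-nonempty? L = map′ (λ a → let x , _ , h = find a in x , h)
      (λ (x , h) → lose {P = _∈B L} (∈-allVectors 𝔽 x) h)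
      (Any.any? (_∈B? L) (allVectors 𝔽 d))

    points : List Point
    points = cartesianProduct (allVectors 𝔽 d) all

    canonical : List Point → List Point
    canonical L = filter (_∈? L) points

    canonical⁺ : ∀ L {y} → y ∈ L → y ∈ canonical L
    canonical⁺ L {u , a} = ∈-filter⁺ (_∈? L) (∈-cartesianProduct⁺ (∈-allVectors 𝔽 u) (∈-all a))

    canonical⁻ : ∀ L {y} → y ∈ canonical L → y ∈ L
    canonical⁻ L h = proj₂ (∈-filter⁻ (_∈? L) {xs = points} h)

    canonicalModel : LinearModel → LinearModel
    canonicalModel M = record
      { L          = canonical L
      ; isAffine   = record
        { nonempty = let y , h = nonempty in y , canonical⁺ L h
        ; closed   = λ t p₁ p₂ p₃ → canonical⁺ L
            (closed t (canonical⁻ L p₁) (canonical⁻ L p₂) (canonical⁻ L p₃))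
        }
      ; B-nonempty = let x , h = B-nonempty in x , λ y p → h y (canonical⁻ L p)
      }
      where
      open LinearModel M
      open IsAffineSubspace isAffine

    -- L = {0}, for which 0 ∈ B(L) because Q(0) = 0.
    originModel : LinearModel
    originModel = record
      { L          = 0ₚ ∷ []
      ; isAffine   = record
        { nonempty = 0ₚ , here refl
        ; closed   = λ { t (here refl) (here refl) (here refl) →
            here (cong₂ _,_ (vec t d) (scal t)) }
        }
      ; B-nonempty = 0ᵥ 𝔽 , λ { _ (here refl) → Λ00 }
      }
      where
      open IsCommutativeRing isCommutativeRing using (+-identityˡ; -‿inverseʳ; zeroˡ; zeroʳ)
      scal : ∀ t → 0# ⊕ t ⊗ (0# ⊝ 0#) ≡ 0#
      scal t = trans (+-identityˡ _) (trans (cong (t ⊗_) (-‿inverseʳ 0#)) (zeroʳ t))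
      vec : ∀ t n → _+ᵥ_ 𝔽 {n} (0ᵥ 𝔽) (_*ᵥ_ 𝔽 t (_-ᵥ_ 𝔽 (0ᵥ 𝔽) (0ᵥ 𝔽))) ≡ 0ᵥ 𝔽
      vec t zero    = refl
      vec t (suc n) = cong₂ _∷_ (scal t) (vec t n)
      0*0 : ∀ n → _*ᵥ_ 𝔽 0# (0ᵥ 𝔽 {n}) ≡ 0ᵥ 𝔽
      0*0 zero    = refl
      0*0 (suc n) = cong₂ _∷_ (zeroˡ 0#) (0*0 n)
      Q0 : Q (0ᵥ 𝔽) ≡ 0#
      Q0 = trans (cong Q (sym (0*0 d))) (trans (homogeneous 0# (0ᵥ 𝔽))
        (trans (cong (_⊗ Q (0ᵥ 𝔽)) (zeroˡ 0#)) (zeroˡ _)))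
      ⟨0,0⟩ : ⟨ 0ᵥ 𝔽 , 0ᵥ 𝔽 ⟩ ≡ 0#
      ⟨0,0⟩ = trans (cong half (trans (cong (λ z → polar 𝔽 Q z (0ᵥ 𝔽)) (sym (0*0 d)))
        (trans (polar-* 0# _ _) (zeroˡ _)))) (zeroˡ _)
      Λ00 : Λ (0ᵥ 𝔽) 0ₚ ≡ 0#
      Λ00 = trans (cong (_⊝ 0#) (trans (cong₂ _⊝_ Q0 ⟨0,0⟩) (-‿inverseʳ 0#))) (-‿inverseʳ 0#)

  ∣P∖B∣ : FinSet V → List Point → ℕ
  ∣P∖B∣ P L = length (filter (λ x → ¬? (x ∈B? L)) (elements P))

  ∣𝒮∖𝒮∣ : FinSet Sphere → List Point → ℕ
  ∣𝒮∖𝒮∣ 𝒮 L = length (filter (λ S → ¬? (S ∈𝒮? L)) (elements 𝒮))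

  module _ (P : FinSet V) (𝒮 : FinSet Sphere) .{{_ : ℕ.NonZero ∣ P ∣}} .{{_ : ℕ.NonZero ∣ 𝒮 ∣}} where

    deviation : List Point → ℚ
    deviation L = (+ ∣P∖B∣ P L / ∣ P ∣) + (+ ∣𝒮∖𝒮∣ 𝒮 L / ∣ 𝒮 ∣)

    private
      deviation-canonical : ∀ L → deviation (canonical L) ≡ deviation L
      deviation-canonical L = cong₂ (λ m n → (+ m / ∣ P ∣) + (+ n / ∣ 𝒮 ∣))
        (cong length (filter-≐ (λ x → ¬? (x ∈B? canonical L)) (λ x → ¬? (x ∈B? L))
          ( (λ ¬h h → ¬h (λ y p → h y (canonical⁻ L p)))
          , (λ ¬h h → ¬h (λ y p → h y (canonical⁺ L p)))) (elements P)))
        (cong length (filter-≐ (λ S → ¬? (S ∈𝒮? canonical L)) (λ S → ¬? (S ∈𝒮? L))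
          ((λ ¬h h → ¬h (canonical⁺ L h)) , (λ ¬h h → ¬h (canonical⁻ L h))) (elements 𝒮)))

      deviation-nonneg : ∀ L → 0ℚ ≤ deviation L
      deviation-nonneg L = ℚ.+-mono-≤ (frac (∣P∖B∣ P L) ∣ P ∣) (frac (∣𝒮∖𝒮∣ 𝒮 L) ∣ 𝒮 ∣)
        where
        frac : ∀ m n .{{_ : ℕ.NonZero n}} → 0ℚ ≤ + m / n
        frac m n = ℚ.nonNegative⁻¹ (+ m / n) {{ℚ.normalize-nonNeg m n}}

      deviation<? : ∀ s → Dec (∃[ M ] deviation (LinearModel.L M) < s)
      deviation<? s = map′ to from (Any.any? good? (sublists points))
        where
        Good : List Point → Set
        Good L = IsAffineSubspace L × (∃[ x ] x ∈B L) × deviation L < s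
        good? : ∀ L → Dec (Good L)
        good? L = affine? L ×-dec (B-nonempty? L ×-dec (deviation L ℚ.<? s))
        to : Any Good (sublists points) → ∃[ M ] deviation (LinearModel.L M) < s
        to a = let L , _ , aff , B , lt = find a
               in record { L = L ; isAffine = aff ; B-nonempty = B } , lt
        from : (∃[ M ] deviation (LinearModel.L M) < s) → Any Good (sublists points)
        from (M , lt) = lose (filter-∈-sublists (_∈? L) points)
          (isAffine , B-nonempty , subst (_< s) (sym (deviation-canonical (LinearModel.L M))) lt)
          where open LinearModel (canonicalModel M) using (isAffine; B-nonempty)
                open LinearModel M using (L)

    dist-lin : ℝ
    dist-lin = infimum (deviation ∘ LinearModel.L) originModel 0ℚ
                 (deviation-nonneg ∘ LinearModel.L) deviation<?

{-# OPTIONS --safe #-}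
module Submission where

-- A sphere S contains x exactly when Λ_x(Φ(S)) = 0, and Λ_x is affine, so B(L) consists of the points
-- lying on all the spheres whose lifts affinely generate L.  A non-incident pair therefore has its
-- point outside B(L) or its sphere outside 𝒮(L), which gives μ ≤ dist.  Conversely, for t with
-- (d+1) μ ≤ t² call a sphere rich if it misses at most the fraction t / (d+1) of P.  By Markov's
-- inequality at most t |𝒮| spheres are not rich.  Let L be the affine span of the lifts of the rich
-- spheres.  While t < (d+1)/(d+2), any d+2 rich spheres share a point x of P by the union bound; an
-- affine subspace with x ∈ B(L) is part of the graph of u ↦ Q(x) − ⟨x,u⟩ and has dimension at most d.
-- So d+1 rich spheres generate L, |P ∖ B(L)| ≤ t |P|, and L deviates by at most 2t.

open import Defs
open import Algebra.Bundles using (CommutativeRing)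
import Algebra.Properties.CommutativeMonoid.Sum as Sum
import Algebra.Properties.Group as GroupProperties
import Algebra.Properties.Monoid.Mult as Mult
import Algebra.Properties.Ring as RingProperties
import Algebra.Solver.Ring.NaturalCoefficients.Default as RingSolver
open import Data.Empty using (⊥-elim)
open import Data.Fin as Fin using (Fin; combine; remQuot)
import Data.Fin.Properties as Fin
open import Data.Integer using (+_; +[1+_]; -[1+_])
import Data.Integer as ℤ
import Data.Integer.Properties as ℤ
open import Data.List using (List; []; _∷_; _++_; map; filter; length; cartesianProduct)
open import Data.List.Membership.Propositional using (_∈_; find)
open import Data.List.Membership.Propositional.Properties using (∈-map⁺; ∈-map⁻; ∈-filter⁺)
import Data.List.Properties as List
open import Data.List.Relation.Unary.All using (All; []; _∷_)
import Data.List.Relation.Unary.All.Properties as All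
open import Data.List.Relation.Unary.Any using (here; there; any?)
open import Data.Nat using (ℕ; zero; suc; NonZero; _≤_; _<_; _+_; _*_; _^_; z≤n; s≤s; _≤?_)
open import Data.Nat.Divisibility using (_∣_; m%n≡0⇒n∣m)
open import Data.Nat.DivMod using (_%_; m≡m%n+[m/n]*n; m%n<n)
import Data.Nat.DivMod as ℕ
open import Data.Nat.ListAction using (sum)
open import Data.Nat.ListAction.Properties using (sum-++)
import Data.Nat.Properties as ℕ
import Data.Nat.Solver as ℕ
open import Data.Product using (∃-syntax; Σ-syntax; _×_; _,_; proj₁; proj₂)
open import Data.Rational as ℚ using (ℚ; mkℚ; 0ℚ; 1ℚ; ½; _/_) renaming (_<_ to _<ℚ_)
import Data.Rational.Properties as ℚ
open import Data.Rational.Solver using (module +-*-Solver)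
open import Data.Rational.Unnormalised as ℚᵘ using (mkℚᵘ; *≡*; *≤*; *<*)
import Data.Rational.Unnormalised.Properties as ℚᵘ
open import Data.Sum using (_⊎_; inj₁; inj₂; map₂)
open import Data.Vec using (Vec; []; _∷_)
import Data.Vec.Properties as Vec
open import Function using (_∘_)
open import Function.Bundles using (_↔_; mk↔ₛ′; Inverse)
open import Function.Construct.Composition using (_↔-∘_)
open import Function.Construct.Symmetry using (↔-sym)
open import Relation.Binary.PropositionalEquality
open import Relation.Nullary using (¬_; Dec; yes; no; ¬?; contradiction)

-- Indicator sums

private variable
  X Y : Set
  R : X → Set

indicator : {X : Set} → Dec X → ℕ
indicator (yes _) = 1
indicator (no _)  = 0

∑ : List X → (X → ℕ) → ℕ
∑ xs f = sum (map f xs)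

length-filter≡∑ : (R? : ∀ x → Dec (R x)) (xs : List X) →
                  length (filter R? xs) ≡ ∑ xs (λ x → indicator (R? x))
length-filter≡∑ R? []       = refl
length-filter≡∑ R? (x ∷ xs) with R? x
... | yes _ = cong suc (length-filter≡∑ R? xs)
... | no _  = length-filter≡∑ R? xs

∑-cong : {f g : X → ℕ} (xs : List X) → (∀ x → f x ≡ g x) → ∑ xs f ≡ ∑ xs g
∑-cong xs f≗g = cong sum (List.map-cong f≗g xs)

∑-mono : {f g : X → ℕ} (xs : List X) → (∀ {x} → x ∈ xs → f x ≤ g x) → ∑ xs f ≤ ∑ xs g
∑-mono []       f≤g = z≤n
∑-mono (x ∷ xs) f≤g = ℕ.+-mono-≤ (f≤g (here refl)) (∑-mono xs (f≤g ∘ there))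

∑-distrib-+ : (f g : X → ℕ) (xs : List X) → ∑ xs (λ x → f x + g x) ≡ ∑ xs f + ∑ xs g
∑-distrib-+ f g []       = refl
∑-distrib-+ f g (x ∷ xs) = trans (cong₂ _+_ refl (∑-distrib-+ f g xs))
  (solve 4 (λ a b c d → a :+ b :+ (c :+ d) := a :+ c :+ (b :+ d)) refl (f x) (g x) (∑ xs f) (∑ xs g))
  where open ℕ.+-*-Solver

∑-*ˡ : (c : ℕ) (f : X → ℕ) (xs : List X) → ∑ xs (λ x → c * f x) ≡ c * ∑ xs f
∑-*ˡ c f []       = sym (ℕ.*-zeroʳ c)
∑-*ˡ c f (x ∷ xs) = trans (cong₂ _+_ refl (∑-*ˡ c f xs)) (sym (ℕ.*-distribˡ-+ c (f x) (∑ xs f)))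

∑-const : (c : ℕ) (xs : List X) → ∑ xs (λ _ → c) ≡ length xs * c
∑-const c []       = refl
∑-const c (x ∷ xs) = cong₂ _+_ refl (∑-const c xs)

∑-swap : (f : X → Y → ℕ) (xs : List X) (ys : List Y) →
         ∑ xs (λ x → ∑ ys (f x)) ≡ ∑ ys (λ y → ∑ xs (λ x → f x y))
∑-swap f []       ys = sym (trans (∑-const 0 ys) (ℕ.*-zeroʳ (length ys)))
∑-swap f (x ∷ xs) ys = trans (cong₂ _+_ refl (∑-swap f xs ys))
  (sym (∑-distrib-+ (f x) (λ y → ∑ xs (λ x → f x y)) ys))

∑-cartesianProduct : (f : X × Y → ℕ) (xs : List X) (ys : List Y) →
                     ∑ (cartesianProduct xs ys) f ≡ ∑ xs (λ x → ∑ ys (λ y → f (x , y)))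
∑-cartesianProduct f []       ys = refl
∑-cartesianProduct f (x ∷ xs) ys = begin
  ∑ (map (x ,_) ys ++ cartesianProduct xs ys) f
    ≡⟨ cong sum (List.map-++ f (map (x ,_) ys) _) ⟩
  sum (map f (map (x ,_) ys) ++ map f (cartesianProduct xs ys))
    ≡⟨ sum-++ (map f (map (x ,_) ys)) _ ⟩
  sum (map f (map (x ,_) ys)) + ∑ (cartesianProduct xs ys) f
    ≡⟨ cong₂ _+_ (cong sum (sym (List.map-∘ ys))) (∑-cartesianProduct f xs ys) ⟩
  ∑ ys (λ y → f (x , y)) + ∑ xs (λ x → ∑ ys (λ y → f (x , y))) ∎
  where open ≡-Reasoning

indicator-¬? : {X : Set} (X? : Dec X) → indicator X? + indicator (¬? X?) ≡ 1
indicator-¬? (yes _) = refl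
indicator-¬? (no _)  = refl

indicator-¬?-antimono : {X Y : Set} (X? : Dec X) (Y? : Dec Y) → (Y → X) → indicator (¬? X?) ≤ indicator (¬? Y?)
indicator-¬?-antimono (yes _) _       _   = z≤n
indicator-¬?-antimono (no _)  (no _)  _   = ℕ.≤-refl
indicator-¬?-antimono (no ¬x) (yes y) y⇒x = contradiction (y⇒x y) ¬x

-- Contrapositively, where `X` fails at least one of `Y` and `Z` fails. Summed over points or over
-- pairs, this becomes a union bound.
indicator-¬?-union : {X Y Z : Set} (X? : Dec X) (Y? : Dec Y) (Z? : Dec Z) → (Y → Z → X) →
                     indicator (¬? X?) ≤ indicator (¬? Y?) + indicator (¬? Z?)
indicator-¬?-union X? (no _)  Z? _     = ℕ.≤-trans (indicator≤1 (¬? X?)) (ℕ.m≤m+n 1 _)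
  where
  indicator≤1 : {X : Set} (X? : Dec X) → indicator X? ≤ 1
  indicator≤1 (yes _) = ℕ.≤-refl
  indicator≤1 (no _)  = z≤n
indicator-¬?-union X? (yes y) Z? y⇒z⇒x = indicator-¬?-antimono X? Z? (y⇒z⇒x y)

-- The pointwise form of Markov's inequality: the weight `c` is paid only where `X` fails, and there
-- `e` covers it.
*-indicator-¬?-≤ : {X : Set} (X? : Dec X) {c e : ℕ} → (¬ X → c ≤ e) → c * indicator (¬? X?) ≤ e
*-indicator-¬?-≤ (yes _)  {c}     _   = ℕ.≤-trans (ℕ.≤-reflexive (ℕ.*-zeroʳ c)) z≤n
*-indicator-¬?-≤ (no ¬x)  {c} {e} c≤e = subst (_≤ e) (sym (ℕ.*-identityʳ c)) (c≤e ¬x)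

-- Natural numbers inside the rationals.

toℚᵘ-/ : ∀ i n .{{_ : NonZero n}} → ℚ.toℚᵘ (i / n) ℚᵘ.≃ (i ℚᵘ./ n)
toℚᵘ-/ i (suc n) = ℚ.toℚᵘ-fromℚᵘ (mkℚᵘ i n)

-- Opaque, so that the gcd normalisation inside `+ n / 1` is not unfolded outside this block; `ι≡/1`
-- leads back to the explicit fraction where the cuts require it.
opaque
  ι : ℕ → ℚ
  ι n = + n / 1

  ι≡/1 : ∀ n → ι n ≡ + n / 1
  ι≡/1 n = refl

  ι-+ : ∀ m n → ι (m + n) ≡ ι m ℚ.+ ι n
  ι-+ m n = ℚ.toℚᵘ-injective (begin
    ℚ.toℚᵘ (ι (m + n))                ≈⟨ toℚᵘ-/ (+ (m + n)) 1 ⟩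
    + (m + n) ℚᵘ./ 1
      ≈⟨ *≡* (cong₂ ℤ._*_ (sym (cong₂ ℤ._+_ (ℤ.*-identityʳ (+ m)) (ℤ.*-identityʳ (+ n)))) refl) ⟩
    (+ m ℚᵘ./ 1) ℚᵘ.+ (+ n ℚᵘ./ 1)     ≈⟨ ℚᵘ.+-cong (toℚᵘ-/ (+ m) 1) (toℚᵘ-/ (+ n) 1) ⟨
    ℚ.toℚᵘ (ι m) ℚᵘ.+ ℚ.toℚᵘ (ι n)    ≈⟨ ℚ.toℚᵘ-homo-+ (ι m) (ι n) ⟨
    ℚ.toℚᵘ (ι m ℚ.+ ι n) ∎)
    where open ℚᵘ.≃-Reasoning

  ι-* : ∀ m n → ι (m * n) ≡ ι m ℚ.* ι n
  ι-* m n = ℚ.toℚᵘ-injective (begin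
    ℚ.toℚᵘ (ι (m * n))                ≈⟨ toℚᵘ-/ (+ (m * n)) 1 ⟩
    + (m * n) ℚᵘ./ 1                  ≈⟨ *≡* (cong (ℤ._* + 1) (ℤ.pos-* m n)) ⟩
    (+ m ℚᵘ./ 1) ℚᵘ.* (+ n ℚᵘ./ 1)     ≈⟨ ℚᵘ.*-cong (toℚᵘ-/ (+ m) 1) (toℚᵘ-/ (+ n) 1) ⟨
    ℚ.toℚᵘ (ι m) ℚᵘ.* ℚ.toℚᵘ (ι n)    ≈⟨ ℚ.toℚᵘ-homo-* (ι m) (ι n) ⟨
    ℚ.toℚᵘ (ι m ℚ.* ι n) ∎)
    where open ℚᵘ.≃-Reasoning

  /-*-cancel : ∀ m n .{{_ : NonZero n}} → (+ m / n) ℚ.* ι n ≡ ι m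
  /-*-cancel m n@(suc n-1) = ℚ.toℚᵘ-injective (begin
    ℚ.toℚᵘ ((+ m / n) ℚ.* ι n)              ≈⟨ ℚ.toℚᵘ-homo-* (+ m / n) (ι n) ⟩
    ℚ.toℚᵘ (+ m / n) ℚᵘ.* ℚ.toℚᵘ (ι n)     ≈⟨ ℚᵘ.*-cong (toℚᵘ-/ (+ m) n) (toℚᵘ-/ (+ n) 1) ⟩
    (+ m ℚᵘ./ n) ℚᵘ.* (+ n ℚᵘ./ 1)
      ≈⟨ *≡* (trans (ℤ.*-identityʳ _) (cong (λ k → + m ℤ.* + suc k) (sym (ℕ.*-identityʳ n-1)))) ⟩
    + m ℚᵘ./ 1                               ≈⟨ toℚᵘ-/ (+ m) 1 ⟨
    ℚ.toℚᵘ (ι m) ∎)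
    where open ℚᵘ.≃-Reasoning

  ι-positive : ∀ n .{{_ : NonZero n}} → ℚ.Positive (ι n)
  ι-positive n = ℚ.normalize-pos n 1

  ι-nonNegative : ∀ n → ℚ.NonNegative (ι n)
  ι-nonNegative n = ℚ.normalize-nonNeg n 1

  ι-mono-≤ : ∀ {m n} → m ≤ n → ι m ℚ.≤ ι n
  ι-mono-≤ {m} {n} m≤n = ℚ.toℚᵘ-cancel-≤ (ℚᵘ.≤-respˡ-≃ (ℚᵘ.≃-sym (toℚᵘ-/ (+ m) 1))
    (ℚᵘ.≤-respʳ-≃ (ℚᵘ.≃-sym (toℚᵘ-/ (+ n) 1)) (*≤* (ℤ.*-monoʳ-≤-nonNeg (+ 1) (ℤ.+≤+ m≤n)))))

  ι-mono-< : ∀ {m n} → suc m ≤ n → ι m <ℚ ι n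
  ι-mono-< {m} {n} m<n = ℚ.toℚᵘ-cancel-< (ℚᵘ.<-respˡ-≃ (ℚᵘ.≃-sym (toℚᵘ-/ (+ m) 1))
    (ℚᵘ.<-respʳ-≃ (ℚᵘ.≃-sym (toℚᵘ-/ (+ n) 1)) (*<* (ℤ.*-monoʳ-<-pos (+ 1) (ℤ.+<+ m<n)))))

ι-cancel-≤ : ∀ {m n} → ι m ℚ.≤ ι n → m ≤ n
ι-cancel-≤ {m} {n} h = ℕ.≮⇒≥ (λ n<m → ℚ.<-irrefl refl (ℚ.<-≤-trans (ι-mono-< n<m) h))

ι-cancel-< : ∀ {m n} → ι m <ℚ ι n → suc m ≤ n
ι-cancel-< {m} {n} h = ℕ.≰⇒> (λ n≤m → ℚ.<-irrefl refl (ℚ.<-≤-trans h (ι-mono-≤ n≤m)))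

-- Finite fields

odd⇒1+2k : ∀ n → ¬ (2 ∣ n) → ∃[ k ] n ≡ 1 + k * 2
odd⇒1+2k n 2∤n with n % 2 | m≡m%n+[m/n]*n n 2 | m%n<n n 2 | m%n≡0⇒n∣m n 2
... | 0           | _  | _               | even = ⊥-elim (2∤n (even refl))
... | 1           | eq | _               | _    = n ℕ./ 2 , eq
... | suc (suc _) | _  | s≤s (s≤s ())    | _

module FieldProperties {q : ℕ} (𝔽 : FiniteField q) where
  open FiniteField 𝔽

  commutativeRing : CommutativeRing _ _
  commutativeRing = record { isCommutativeRing = isCommutativeRing }

  open CommutativeRing commutativeRing public
    using (commutativeSemiring; ring; +-group; +-monoid; +-commutativeMonoid;
           +-assoc; +-comm; +-identityˡ; +-identityʳ; -‿inverseˡ; -‿inverseʳ;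
           *-identityˡ; *-identityʳ; zeroˡ; zeroʳ)
  open RingProperties ring public using (-1*x≈-x; -‿involutive; +-cancelˡ; +-cancelʳ)
  open GroupProperties +-group public using () renaming (x∙y⁻¹≈ε⇒x≈y to x⊝y≡0⇒x≡y)
  open RingSolver commutativeSemiring public using (solve; _:=_; _:+_; _:*_)

  x⊝x≡0 : ∀ x → x ⊝ x ≡ 0#
  x⊝x≡0 = -‿inverseʳ

  x⊝y⊕y≡x : ∀ x y → (x ⊝ y) ⊕ y ≡ x
  x⊝y⊕y≡x x y = trans (+-assoc x (⊝ y) y) (trans (cong (x ⊕_) (-‿inverseˡ y)) (+-identityʳ x))

  x⊝y≡x⊕-1*y : ∀ x y → x ⊝ y ≡ x ⊕ (⊝ 1#) ⊗ y
  x⊝y≡x⊕-1*y x y = cong (x ⊕_) (sym (-1*x≈-x y))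

  [x⊕y]⊝[x⊕z]≡y⊝z : ∀ x y z → (x ⊕ y) ⊝ (x ⊕ z) ≡ y ⊝ z
  [x⊕y]⊝[x⊕z]≡y⊝z x y z = begin
    (x ⊕ y) ⊝ (x ⊕ z)                              ≡⟨ x⊝y≡x⊕-1*y _ _ ⟩
    (x ⊕ y) ⊕ (⊝ 1#) ⊗ (x ⊕ z)
      ≡⟨ solve 4 (λ x y z m → (x :+ y) :+ m :* (x :+ z) := (x :+ m :* x) :+ (y :+ m :* z)) refl x y z (⊝ 1#) ⟩
    (x ⊕ (⊝ 1#) ⊗ x) ⊕ (y ⊕ (⊝ 1#) ⊗ z)
      ≡⟨ cong₂ _⊕_ (trans (sym (x⊝y≡x⊕-1*y x x)) (x⊝x≡0 x)) (sym (x⊝y≡x⊕-1*y y z)) ⟩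
    0# ⊕ (y ⊝ z)                                   ≡⟨ +-identityˡ _ ⟩
    y ⊝ z                                          ∎
    where open ≡-Reasoning

  open Mult +-monoid using () renaming (_×_ to _·#_)

  -- Translation by 1 permutes the field, so the sum of all elements equals itself plus q · 1.
  q·1≡0 : q ·# 1# ≡ 0#
  q·1≡0 = sym (+-cancelˡ total 0# (q ·# 1#) (begin
    total ⊕ 0#                                    ≡⟨ +-identityʳ total ⟩
    total                                         ≡⟨ sum-permute element π ⟩
    sumᶠ (element ∘ Inverse.to π)
      ≡⟨ sum-cong-≗ (λ i → Inverse.strictlyInverseʳ finite (element i ⊕ 1#)) ⟩
    sumᶠ (λ i → element i ⊕ 1#)                    ≡⟨ sumᶠ-distrib-+ element (λ _ → 1#) ⟩
    total ⊕ sumᶠ {q} (λ _ → 1#)                    ≡⟨ cong (total ⊕_) (sum-replicate q) ⟩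
    total ⊕ q ·# 1#                               ∎))
    where
    open ≡-Reasoning
    open Sum +-commutativeMonoid using (sum-permute; sum-cong-≗; sum-replicate)
      renaming (sum to sumᶠ; ∑-distrib-+ to sumᶠ-distrib-+)
    element : Fin q → Carrier
    element = Inverse.from finite
    total : Carrier
    total = sumᶠ element
    shift : Carrier ↔ Carrier
    shift = mk↔ₛ′ (_⊕ 1#) (_⊝ 1#) (λ x → x⊝y⊕y≡x x 1#)
      (λ x → trans (+-assoc x 1# (⊝ 1#)) (trans (cong (x ⊕_) (x⊝x≡0 1#)) (+-identityʳ x)))
    π : Fin q ↔ Fin q
    π = finite ↔-∘ (shift ↔-∘ ↔-sym finite)

  -- With `q` odd, `q ·# 1#` is `1#` followed by an even number of ones. If `1# ⊕ 1#` vanished,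
  -- these would cancel in pairs and leave `1# ≡ 0#`.
  2≢0 : ¬ (2 ∣ q) → 1# ⊕ 1# ≢ 0#
  2≢0 2∤q 2≡0 = 0≢1 (begin
    0#                              ≡⟨ q·1≡0 ⟨
    q ·# 1#                         ≡⟨ cong (_·# 1#) (proj₂ (odd⇒1+2k q 2∤q)) ⟩
    1# ⊕ (proj₁ (odd⇒1+2k q 2∤q) * 2) ·# 1#   ≡⟨ cong (1# ⊕_) (even·1≡0 (proj₁ (odd⇒1+2k q 2∤q))) ⟩
    1# ⊕ 0#                         ≡⟨ +-identityʳ 1# ⟩
    1#                              ∎)
    where
    open ≡-Reasoning
    even·1≡0 : ∀ k → (k * 2) ·# 1# ≡ 0#
    even·1≡0 zero    = refl
    even·1≡0 (suc k) = trans (sym (+-assoc 1# 1# _)) (trans (cong₂ _⊕_ 2≡0 (even·1≡0 k)) (+-identityʳ 0#))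

  half-double : 1# ⊕ 1# ≢ 0# → ∀ x → half ((1# ⊕ 1#) ⊗ x) ≡ x
  half-double 2≢0 x = begin
    ((1# ⊕ 1#) ⊗ x) ⊗ (1# ⊕ 1#) ⁻¹
      ≡⟨ solve 3 (λ t x i → (t :* x) :* i := x :* (t :* i)) refl (1# ⊕ 1#) x ((1# ⊕ 1#) ⁻¹) ⟩
    x ⊗ ((1# ⊕ 1#) ⊗ (1# ⊕ 1#) ⁻¹)     ≡⟨ cong (x ⊗_) (⁻¹-inverseʳ _ 2≢0) ⟩
    x ⊗ 1#                             ≡⟨ *-identityʳ x ⟩
    x                                  ∎
    where open ≡-Reasoning

  -- Comparing dimensions by counting vectors.

  encode : ∀ {k} → Vector 𝔽 k → Fin (q ^ k)
  encode []      = Fin.zero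
  encode (a ∷ v) = combine (Inverse.to finite a) (encode v)

  decode : ∀ {k} → Fin (q ^ k) → Vector 𝔽 k
  decode {zero}  _ = []
  decode {suc k} i = let a , j = remQuot {q} (q ^ k) i in Inverse.from finite a ∷ decode j

  encode∘decode : ∀ {k} (i : Fin (q ^ k)) → encode {k} (decode i) ≡ i
  encode∘decode {zero}  Fin.zero = refl
  encode∘decode {suc k} i = trans
    (cong₂ combine (Inverse.strictlyInverseˡ finite _) (encode∘decode {k} _))
    (Fin.combine-remQuot {q} (q ^ k) i)

  encode-injective : ∀ {k} (v w : Vector 𝔽 k) → encode v ≡ encode w → v ≡ w
  encode-injective []      []      _  = refl
  encode-injective (a ∷ v) (b ∷ w) eq =
    let a≡b , v≡w = Fin.combine-injective (Inverse.to finite a) (encode v) (Inverse.to finite b) (encode w) eq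
    in cong₂ _∷_ (trans (sym (Inverse.strictlyInverseʳ finite a))
                   (trans (cong (Inverse.from finite) a≡b) (Inverse.strictlyInverseʳ finite b)))
                 (encode-injective v w v≡w)

  -- If `d < k`, then `q ^ d < q ^ k` because `1 < q`, and `f` read through the base-`q` codes of
  -- vectors would violate the pigeonhole principle.
  injective⇒dim≤ : ∀ {k d} (f : Vector 𝔽 k → Vector 𝔽 d) →
                   (∀ {v w} → f v ≡ f w → v ≡ w) → k ≤ d
  injective⇒dim≤ {k} {d} f f-inj = ℕ.≮⇒≥ (λ d<k → ℕ.<⇒≱ (ℕ.^-monoʳ-< q 1<q d<k)
    (Fin.injective⇒≤ {f = encode {d} ∘ f ∘ decode {k}} (λ {i} {j} eq →
      trans (sym (encode∘decode {k} i))
        (trans (cong encode (f-inj (encode-injective _ _ eq))) (encode∘decode {k} j)))))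

  -- Writing ⊝ 1# as a variable m turns the affine laws into semiring identities.
  affine-closed : ∀ t s s′ s″ a b c z y →
    (a ⊕ s ⊗ (z ⊝ y)) ⊕ t ⊗ ((b ⊕ s′ ⊗ (z ⊝ y)) ⊝ (c ⊕ s″ ⊗ (z ⊝ y)))
      ≡ (a ⊕ t ⊗ (b ⊝ c)) ⊕ (s ⊕ t ⊗ (s′ ⊝ s″)) ⊗ (z ⊝ y)
  affine-closed t s s′ s″ a b c z y
    rewrite x⊝y≡x⊕-1*y (b ⊕ s′ ⊗ (z ⊝ y)) (c ⊕ s″ ⊗ (z ⊝ y)) | x⊝y≡x⊕-1*y b c | x⊝y≡x⊕-1*y s′ s″ =
    solve 9 (λ t s s′ s″ a b c w m →
      (a :+ s :* w) :+ t :* ((b :+ s′ :* w) :+ m :* (c :+ s″ :* w))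
        := (a :+ t :* (b :+ m :* c)) :+ (s :+ t :* (s′ :+ m :* s″)) :* w)
      refl t s s′ s″ a b c (z ⊝ y) (⊝ 1#)

  affine-constant : ∀ t y → y ⊕ t ⊗ (y ⊝ y) ≡ y
  affine-constant t y = trans (cong (λ w → y ⊕ t ⊗ w) (x⊝x≡0 y))
    (trans (cong (y ⊕_) (zeroʳ t)) (+-identityʳ y))

  affine-zero : ∀ a z y → a ⊕ 0# ⊗ (z ⊝ y) ≡ a
  affine-zero a z y = trans (cong (a ⊕_) (zeroˡ _)) (+-identityʳ a)

  affine-one : ∀ z y → y ⊕ 1# ⊗ (z ⊝ y) ≡ z
  affine-one z y = trans (cong (y ⊕_) (*-identityˡ _)) (trans (+-comm y (z ⊝ y)) (x⊝y⊕y≡x z y))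

  affine-cancel : ∀ t a b z y → a ⊕ t ⊗ (z ⊝ y) ≡ b ⊕ t ⊗ (z ⊝ y) → a ≡ b
  affine-cancel t a b z y = +-cancelʳ (t ⊗ (z ⊝ y)) a b

  -- Subtracting the two sides leaves `(t ⊝ s) ⊗ (z ⊝ y) ≡ b ⊝ a`, and `t ⊝ s` is invertible. A
  -- dependency with different coefficients at `z` thus expresses `z` through the other points.
  affine-solve : ∀ {t s} → t ≢ s → ∀ a b z y → a ⊕ t ⊗ (z ⊝ y) ≡ b ⊕ s ⊗ (z ⊝ y) →
                 z ≡ y ⊕ (t ⊝ s) ⁻¹ ⊗ (b ⊝ a)
  affine-solve {t} {s} t≢s a b z y eq = begin
    z                              ≡⟨ affine-one z y ⟨
    y ⊕ 1# ⊗ w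
      ≡⟨ cong (λ o → y ⊕ o ⊗ w) (⁻¹-inverseʳ (t ⊝ s) (λ e → t≢s (x⊝y≡0⇒x≡y t s e))) ⟨
    y ⊕ ((t ⊝ s) ⊗ i) ⊗ w
      ≡⟨ solve 4 (λ y r i w → y :+ (r :* i) :* w := y :+ i :* (r :* w)) refl y (t ⊝ s) i w ⟩
    y ⊕ i ⊗ ((t ⊝ s) ⊗ w)          ≡⟨ cong (λ e → y ⊕ i ⊗ e) step ⟩
    y ⊕ i ⊗ (b ⊝ a)                ∎
    where
    open ≡-Reasoning
    w = z ⊝ y
    i = (t ⊝ s) ⁻¹
    step : (t ⊝ s) ⊗ w ≡ b ⊝ a
    step = begin
      (t ⊝ s) ⊗ w                              ≡⟨ cong (_⊗ w) (x⊝y≡x⊕-1*y t s) ⟩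
      (t ⊕ (⊝ 1#) ⊗ s) ⊗ w
        ≡⟨ solve 4 (λ t s w m → (t :+ m :* s) :* w := t :* w :+ m :* (s :* w)) refl t s w (⊝ 1#) ⟩
      t ⊗ w ⊕ (⊝ 1#) ⊗ (s ⊗ w)                 ≡⟨ x⊝y≡x⊕-1*y _ _ ⟨
      t ⊗ w ⊝ s ⊗ w                            ≡⟨ [x⊕y]⊝[x⊕z]≡y⊝z a _ _ ⟨
      (a ⊕ t ⊗ w) ⊝ (a ⊕ s ⊗ w)                ≡⟨ cong (_⊝ (a ⊕ s ⊗ w)) eq ⟩
      (b ⊕ s ⊗ w) ⊝ (a ⊕ s ⊗ w)                ≡⟨ cong₂ _⊝_ (+-comm b _) (+-comm a _) ⟩
      (s ⊗ w ⊕ b) ⊝ (s ⊗ w ⊕ a)                ≡⟨ [x⊕y]⊝[x⊕z]≡y⊝z (s ⊗ w) b a ⟩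
      b ⊝ a                                    ∎

  -- The affine identities, coordinate by coordinate.

  infixl 6 _+v_ _-v_
  infixl 7 _*v_
  _+v_ _-v_ : ∀ {n} → Vector 𝔽 n → Vector 𝔽 n → Vector 𝔽 n
  _+v_ = _+ᵥ_ 𝔽
  _-v_ = _-ᵥ_ 𝔽
  _*v_ : ∀ {n} → Carrier → Vector 𝔽 n → Vector 𝔽 n
  _*v_ = _*ᵥ_ 𝔽

  affine-closedᵥ : ∀ t s s′ s″ {n} (a b c z y : Vector 𝔽 n) →
    (a +v s *v (z -v y)) +v t *v ((b +v s′ *v (z -v y)) -v (c +v s″ *v (z -v y)))
      ≡ (a +v t *v (b -v c)) +v (s ⊕ t ⊗ (s′ ⊝ s″)) *v (z -v y)
  affine-closedᵥ t s s′ s″ []      []      []      []      []      = refl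
  affine-closedᵥ t s s′ s″ (a ∷ as) (b ∷ bs) (c ∷ cs) (z ∷ zs) (y ∷ ys) =
    cong₂ _∷_ (affine-closed t s s′ s″ a b c z y) (affine-closedᵥ t s s′ s″ as bs cs zs ys)

  affine-constantᵥ : ∀ t {n} (y : Vector 𝔽 n) → y +v t *v (y -v y) ≡ y
  affine-constantᵥ t []      = refl
  affine-constantᵥ t (y ∷ ys) = cong₂ _∷_ (affine-constant t y) (affine-constantᵥ t ys)

  affine-zeroᵥ : ∀ {n} (a z y : Vector 𝔽 n) → a +v 0# *v (z -v y) ≡ a
  affine-zeroᵥ []       []       []       = refl
  affine-zeroᵥ (a ∷ as) (z ∷ zs) (y ∷ ys) = cong₂ _∷_ (affine-zero a z y) (affine-zeroᵥ as zs ys)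

  affine-oneᵥ : ∀ {n} (z y : Vector 𝔽 n) → y +v 1# *v (z -v y) ≡ z
  affine-oneᵥ []       []       = refl
  affine-oneᵥ (z ∷ zs) (y ∷ ys) = cong₂ _∷_ (affine-one z y) (affine-oneᵥ zs ys)

  affine-cancelᵥ : ∀ t {n} (a b z y : Vector 𝔽 n) → a +v t *v (z -v y) ≡ b +v t *v (z -v y) → a ≡ b
  affine-cancelᵥ t []       []       []       []       _  = refl
  affine-cancelᵥ t (a ∷ as) (b ∷ bs) (z ∷ zs) (y ∷ ys) eq = let eq₁ , eq₂ = Vec.∷-injective eq in
    cong₂ _∷_ (affine-cancel t a b z y eq₁) (affine-cancelᵥ t as bs zs ys eq₂)

  affine-solveᵥ : ∀ {t s} → t ≢ s → ∀ {n} (a b z y : Vector 𝔽 n) →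
    a +v t *v (z -v y) ≡ b +v s *v (z -v y) → z ≡ y +v (t ⊝ s) ⁻¹ *v (b -v a)
  affine-solveᵥ t≢s []       []       []       []       _  = refl
  affine-solveᵥ t≢s (a ∷ as) (b ∷ bs) (z ∷ zs) (y ∷ ys) eq = let eq₁ , eq₂ = Vec.∷-injective eq in
    cong₂ _∷_ (affine-solve t≢s a b z y eq₁) (affine-solveᵥ t≢s as bs zs ys eq₂)

  +v-comm : ∀ {n} (x y : Vector 𝔽 n) → x +v y ≡ y +v x
  +v-comm = Vec.zipWith-comm +-comm

  x-vy≡x+v-1*vy : ∀ {n} (x y : Vector 𝔽 n) → x -v y ≡ x +v (⊝ 1#) *v y
  x-vy≡x+v-1*vy []       []       = refl
  x-vy≡x+v-1*vy (x ∷ xs) (y ∷ ys) = cong₂ _∷_ (x⊝y≡x⊕-1*y x y) (x-vy≡x+v-1*vy xs ys)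

-- Lifted spheres and spans of their lifts

module SphereProperties {q d : ℕ} (𝔽 : FiniteField q) (𝑸 : QuadraticForm 𝔽 d) where
  open FiniteField 𝔽
  open FieldProperties 𝔽
  open QuadraticForm 𝑸 renaming (form to Q; ⟨_,_⟩ to β)
  open Spheres 𝔽 𝑸

  private
    B : V → V → Carrier
    B = polar 𝔽 Q

  polar-sym : ∀ x y → B x y ≡ B y x
  polar-sym x y = begin
    (Q (x +v y) ⊝ Q x) ⊝ Q y           ≡⟨ cong (λ z → (Q z ⊝ Q x) ⊝ Q y) (+v-comm x y) ⟩
    (Q (y +v x) ⊝ Q x) ⊝ Q y
      ≡⟨ solve 3 (λ a b c → (a :+ b) :+ c := (a :+ c) :+ b) refl (Q (y +v x)) (⊝ Q x) (⊝ Q y) ⟩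
    (Q (y +v x) ⊝ Q y) ⊝ Q x           ∎
    where open ≡-Reasoning

  -- The axioms give linearity in the first argument, so the arguments are exchanged, expanded and
  -- exchanged back; `half` is multiplication by a constant and distributes.
  β-affine : ∀ x t u v w → (β x (u +v t *v (v -v w))) ≡ (β x u) ⊕ t ⊗ ((β x v) ⊕ (⊝ 1#) ⊗ β x w)
  β-affine x t u v w = begin
    half (B x (u +v t *v (v -v w)))                          ≡⟨ cong half (polar-sym x _) ⟩
    half (B (u +v t *v (v -v w)) x)                          ≡⟨ cong half (polar-+ u _ x) ⟩
    half (B u x ⊕ B (t *v (v -v w)) x)                       ≡⟨ cong (λ z → half (B u x ⊕ z)) (polar-* t _ x) ⟩
    half (B u x ⊕ t ⊗ B (v -v w) x)
      ≡⟨ cong (λ z → half (B u x ⊕ t ⊗ B z x)) (x-vy≡x+v-1*vy v w) ⟩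
    half (B u x ⊕ t ⊗ B (v +v (⊝ 1#) *v w) x)
      ≡⟨ cong (λ z → half (B u x ⊕ t ⊗ z)) (trans (polar-+ v _ x) (cong (B v x ⊕_) (polar-* (⊝ 1#) w x))) ⟩
    half (B u x ⊕ t ⊗ (B v x ⊕ (⊝ 1#) ⊗ B w x))
      ≡⟨ solve 6 (λ a b c t m h → (a :+ t :* (b :+ m :* c)) :* h := a :* h :+ t :* (b :* h :+ m :* (c :* h)))
           refl (B u x) (B v x) (B w x) t (⊝ 1#) ((1# ⊕ 1#) ⁻¹) ⟩
    half (B u x) ⊕ t ⊗ (half (B v x) ⊕ (⊝ 1#) ⊗ half (B w x))
      ≡⟨ cong₂ (λ a b → half a ⊕ t ⊗ b) (polar-sym u x)
           (cong₂ (λ b c → half b ⊕ (⊝ 1#) ⊗ half c) (polar-sym v x) (polar-sym w x)) ⟩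
    half (B x u) ⊕ t ⊗ (half (B x v) ⊕ (⊝ 1#) ⊗ half (B x w)) ∎
    where open ≡-Reasoning

  Λ-expand : ∀ x u a → Λ x (u , a) ≡ (Q x ⊕ (⊝ 1#) ⊗ β x u) ⊕ (⊝ 1#) ⊗ a
  Λ-expand x u a = trans (x⊝y≡x⊕-1*y _ a) (cong (_⊕ (⊝ 1#) ⊗ a) (x⊝y≡x⊕-1*y (Q x) (β x u)))

  Λ-affine : ∀ x t y₁ y₂ y₃ → Λ x (y₁ +ₚ t *ₚ (y₂ -ₚ y₃)) ≡ Λ x y₁ ⊕ t ⊗ (Λ x y₂ ⊝ Λ x y₃)
  Λ-affine x t y₁@(u , a) y₂@(v , b) y₃@(w , c) = begin
    Λ x (y₁ +ₚ t *ₚ (y₂ -ₚ y₃))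
      ≡⟨ Λ-expand x (u +v t *v (v -v w)) (a ⊕ t ⊗ (b ⊝ c)) ⟩
    (Q x ⊕ m ⊗ (β x (u +v t *v (v -v w)))) ⊕ m ⊗ (a ⊕ t ⊗ (b ⊝ c))
      ≡⟨ cong₂ (λ i j → (Q x ⊕ m ⊗ i) ⊕ m ⊗ (a ⊕ t ⊗ j)) (β-affine x t u v w) (x⊝y≡x⊕-1*y b c) ⟩
    (Q x ⊕ m ⊗ ((β x u) ⊕ t ⊗ ((β x v) ⊕ m ⊗ β x w))) ⊕ m ⊗ (a ⊕ t ⊗ (b ⊕ m ⊗ c))
      -- The difference of the last two values of `Λ x` contains `Q x ⊝ Q x`, which the semiring
      -- solver cannot cancel; it is inserted beforehand as a zero multiplied by `t`.
      ≡⟨ +-identityʳ _ ⟨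
    ((Q x ⊕ m ⊗ ((β x u) ⊕ t ⊗ ((β x v) ⊕ m ⊗ β x w))) ⊕ m ⊗ (a ⊕ t ⊗ (b ⊕ m ⊗ c))) ⊕ 0#
      ≡⟨ cong₂ _⊕_ refl (trans (sym (zeroʳ t)) (cong (t ⊗_) (trans (sym (x⊝x≡0 (Q x))) (x⊝y≡x⊕-1*y (Q x) (Q x))))) ⟩
    ((Q x ⊕ m ⊗ ((β x u) ⊕ t ⊗ ((β x v) ⊕ m ⊗ β x w))) ⊕ m ⊗ (a ⊕ t ⊗ (b ⊕ m ⊗ c)))
      ⊕ t ⊗ (Q x ⊕ m ⊗ Q x)
      ≡⟨ solve 9 (λ o i j k a b c t m →
           ((o :+ m :* (i :+ t :* (j :+ m :* k))) :+ m :* (a :+ t :* (b :+ m :* c))) :+ t :* (o :+ m :* o)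
           := ((o :+ m :* i) :+ m :* a)
              :+ t :* (((o :+ m :* j) :+ m :* b) :+ m :* ((o :+ m :* k) :+ m :* c)))
         refl (Q x) (β x u) (β x v) (β x w) a b c t m ⟩
    ((Q x ⊕ m ⊗ β x u) ⊕ m ⊗ a)
      ⊕ t ⊗ (((Q x ⊕ m ⊗ β x v) ⊕ m ⊗ b) ⊕ m ⊗ ((Q x ⊕ m ⊗ β x w) ⊕ m ⊗ c))
      ≡⟨ cong₂ (λ i j → i ⊕ t ⊗ j) (Λ-expand x u a)
           (trans (x⊝y≡x⊕-1*y _ _) (cong₂ (λ i j → i ⊕ m ⊗ j) (Λ-expand x v b) (Λ-expand x w c))) ⟨
    Λ x y₁ ⊕ t ⊗ (Λ x y₂ ⊝ Λ x y₃) ∎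
    where
    open ≡-Reasoning
    m = ⊝ 1#

  Λ-affine-zero : ∀ {x} t {y₁ y₂ y₃} → Λ x y₁ ≡ 0# → Λ x y₂ ≡ 0# → Λ x y₃ ≡ 0# →
                  Λ x (y₁ +ₚ t *ₚ (y₂ -ₚ y₃)) ≡ 0#
  Λ-affine-zero {x} t {y₁} {y₂} {y₃} h₁ h₂ h₃ = begin
    Λ x (y₁ +ₚ t *ₚ (y₂ -ₚ y₃))        ≡⟨ Λ-affine x t y₁ y₂ y₃ ⟩
    Λ x y₁ ⊕ t ⊗ (Λ x y₂ ⊝ Λ x y₃)     ≡⟨ cong₂ _⊕_ h₁ (cong (t ⊗_) (cong₂ _⊝_ h₂ h₃)) ⟩
    0# ⊕ t ⊗ (0# ⊝ 0#)                 ≡⟨ affine-constant t 0# ⟩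
    0#                                 ∎
    where open ≡-Reasoning

  -- Both scalars equal `Q x ⊝ β x u`: the zero set of `Λ x` is a graph over the first component.
  Λ-zero-unique : ∀ x u {a b} → Λ x (u , a) ≡ 0# → Λ x (u , b) ≡ 0# → a ≡ b
  Λ-zero-unique x u ha hb = trans (sym (x⊝y≡0⇒x≡y _ _ ha)) (x⊝y≡0⇒x≡y _ _ hb)

  Q-reflect : ∀ c → Q ((⊝ 1#) *v c) ≡ Q c
  Q-reflect c = trans (homogeneous (⊝ 1#) c)
    (trans (cong (_⊗ Q c) (trans (-1*x≈-x (⊝ 1#)) (-‿involutive 1#))) (*-identityˡ (Q c)))

  -- The definition of the polar form at `x` and the negative of `c`, rearranged, since negating `c`
  -- preserves `Q` and negates `B x c`.
  Q-translate : ∀ x c → Q (x -v c) ≡ (Q x ⊝ B x c) ⊕ Q c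
  Q-translate x c = begin
    Q (x -v c)                                     ≡⟨ cong Q (x-vy≡x+v-1*vy x c) ⟩
    Q (x +v m *v c)                                ≡⟨ x⊝y⊕y≡x _ (Q x) ⟨
    (Q (x +v m *v c) ⊝ Q x) ⊕ Q x                  ≡⟨ cong (_⊕ Q x) (x⊝y⊕y≡x _ (Q (m *v c))) ⟨
    (B x (m *v c) ⊕ Q (m *v c)) ⊕ Q x              ≡⟨ cong₂ (λ i j → (i ⊕ j) ⊕ Q x) polar-neg (Q-reflect c) ⟩
    ((⊝ B x c) ⊕ Q c) ⊕ Q x
      ≡⟨ solve 3 (λ i j k → (i :+ j) :+ k := (k :+ i) :+ j) refl (⊝ B x c) (Q c) (Q x) ⟩
    (Q x ⊝ B x c) ⊕ Q c                            ∎
    where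
    open ≡-Reasoning
    m = ⊝ 1#
    polar-neg : B x (m *v c) ≡ ⊝ B x c
    polar-neg = trans (polar-sym x _) (trans (polar-* m c x) (trans (-1*x≈-x _) (cong ⊝_ (polar-sym c x))))

  module _ (2≢0 : 1# ⊕ 1# ≢ 0#) where

    -- The factor 2 in the first component of `Φ` is there to cancel the half in the bilinear form.
    β-double : ∀ x c → (β x ((1# ⊕ 1#) *v c)) ≡ B x c
    β-double x c = trans
      (cong half (trans (polar-sym x _) (trans (polar-* _ c x) (cong ((1# ⊕ 1#) ⊗_) (polar-sym c x)))))
      (half-double 2≢0 (B x c))

    -- By `Q-translate`, `x` lies on the sphere exactly when `Q x ⊝ B x c ≡ r ⊝ Q c`, which is the
    -- vanishing of the right-hand side here.
    Λ-Φ : ∀ x c r → Λ x (Φ (c , r)) ≡ (Q x ⊝ B x c) ⊝ (r ⊝ Q c)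
    Λ-Φ x c r = cong (λ z → (Q x ⊝ z) ⊝ (r ⊝ Q c)) (β-double x c)

    ∈ₛ⇒Λ : ∀ {x} S → x ∈ₛ S → Λ x (Φ S) ≡ 0#
    ∈ₛ⇒Λ {x} (c , r) h = trans (Λ-Φ x c r)
      (trans (cong (_⊝ (r ⊝ Q c)) (+-cancelʳ (Q c) _ _
        (trans (sym (Q-translate x c)) (trans h (sym (x⊝y⊕y≡x r (Q c)))))))
        (x⊝x≡0 (r ⊝ Q c)))

    Λ⇒∈ₛ : ∀ {x} S → Λ x (Φ S) ≡ 0# → x ∈ₛ S
    Λ⇒∈ₛ {x} (c , r) h = trans (Q-translate x c)
      (trans (cong (_⊕ Q c) (x⊝y≡0⇒x≡y _ _ (trans (sym (Λ-Φ x c r)) h))) (x⊝y⊕y≡x r (Q c)))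

  -- Affine combinations and spans in the lifted space.

  -- The point y + Σ tᵢ (zᵢ - y). Relative to the base point `y` the coefficients are unconstrained,
  -- so they range over all of 𝔽ᵏ and can be counted.
  combination : Point → ∀ {k} → Vec Point k → Vector 𝔽 k → Point
  combination y []       []      = y
  combination y (z ∷ zs) (t ∷ v) = combination y zs v +ₚ t *ₚ (z -ₚ y)

  -- `combination` is affine in its coefficient vector, so its image is closed under affine
  -- operations.
  combination-closed : ∀ y {k} (zs : Vec Point k) t v₁ v₂ v₃ →
    combination y zs v₁ +ₚ t *ₚ (combination y zs v₂ -ₚ combination y zs v₃)
      ≡ combination y zs (v₁ +v t *v (v₂ -v v₃))
  combination-closed y []       t [] [] [] = cong₂ _,_ (affine-constantᵥ t (proj₁ y)) (affine-constant t (proj₂ y))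
  combination-closed y (z ∷ zs) t (s ∷ v₁) (s′ ∷ v₂) (s″ ∷ v₃) = trans
    (cong₂ _,_ (affine-closedᵥ t s s′ s″ _ _ _ (proj₁ z) (proj₁ y)) (affine-closed t s s′ s″ _ _ _ (proj₂ z) (proj₂ y)))
    (cong (_+ₚ (s ⊕ t ⊗ (s′ ⊝ s″)) *ₚ (z -ₚ y)) (combination-closed y zs t v₁ v₂ v₃))

  combination-weaken : ∀ y z {k} (zs : Vec Point k) v → combination y (z ∷ zs) (0# ∷ v) ≡ combination y zs v
  combination-weaken y z zs v = cong₂ _,_ (affine-zeroᵥ _ (proj₁ z) (proj₁ y)) (affine-zero _ (proj₂ z) (proj₂ y))

  combination-base : ∀ y {k} (zs : Vec Point k) → combination y zs (0ᵥ 𝔽) ≡ y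
  combination-base y []       = refl
  combination-base y (z ∷ zs) = trans (combination-weaken y z zs (0ᵥ 𝔽)) (combination-base y zs)

  combination-head : ∀ y z {k} (zs : Vec Point k) → combination y (z ∷ zs) (1# ∷ 0ᵥ 𝔽) ≡ z
  combination-head y z zs = trans (cong (_+ₚ 1# *ₚ (z -ₚ y)) (combination-base y zs))
    (cong₂ _,_ (affine-oneᵥ (proj₁ z) (proj₁ y)) (affine-one (proj₂ z) (proj₂ y)))

  span : Point → ∀ {k} → Vec Point k → List Point
  span y {k} zs = map (combination y zs) (allVectors 𝔽 k)

  ∈-span⁺ : ∀ y {k} (zs : Vec Point k) v → combination y zs v ∈ span y zs
  ∈-span⁺ y zs v = ∈-map⁺ (combination y zs) (∈-allVectors 𝔽 v)

  ∈-span⁻ : ∀ y {k} (zs : Vec Point k) {p} → p ∈ span y zs → ∃[ v ] p ≡ combination y zs v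
  ∈-span⁻ y zs p∈ = let v , _ , eq = ∈-map⁻ (combination y zs) p∈ in v , eq

  base∈span : ∀ y {k} (zs : Vec Point k) → y ∈ span y zs
  base∈span y zs = subst (_∈ span y zs) (combination-base y zs) (∈-span⁺ y zs (0ᵥ 𝔽))

  head∈span : ∀ y z {k} (zs : Vec Point k) → z ∈ span y (z ∷ zs)
  head∈span y z zs = subst (_∈ span y (z ∷ zs)) (combination-head y z zs) (∈-span⁺ y (z ∷ zs) (1# ∷ 0ᵥ 𝔽))

  span-weaken : ∀ y z {k} (zs : Vec Point k) {p} → p ∈ span y zs → p ∈ span y (z ∷ zs)
  span-weaken y z zs p∈ with ∈-span⁻ y zs p∈
  ... | v , refl = subst (_∈ span y (z ∷ zs)) (combination-weaken y z zs v) (∈-span⁺ y (z ∷ zs) (0# ∷ v))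

  span-affine : ∀ y {k} (zs : Vec Point k) → IsAffineSubspace (span y zs)
  span-affine y zs = record { nonempty = y , base∈span y zs ; closed = closed }
    where
    closed : ∀ t {p₁ p₂ p₃} → p₁ ∈ span y zs → p₂ ∈ span y zs → p₃ ∈ span y zs →
             p₁ +ₚ t *ₚ (p₂ -ₚ p₃) ∈ span y zs
    closed t h₁ h₂ h₃ with ∈-span⁻ y zs h₁ | ∈-span⁻ y zs h₂ | ∈-span⁻ y zs h₃
    ... | v₁ , refl | v₂ , refl | v₃ , refl =
      subst (_∈ span y zs) (sym (combination-closed y zs t v₁ v₂ v₃)) (∈-span⁺ y zs _)

  -- A point of the larger span is p + t (z - y) with `p` in the smaller one. `Λ x` is affine and
  -- vanishes at `p`, `z` and `y`.
  ∈B-extend : ∀ y z {k} (zs : Vec Point k) {x} → x ∈B span y zs → Λ x z ≡ 0# → x ∈B span y (z ∷ zs)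
  ∈B-extend y z zs {x} x∈B Λz p p∈ with ∈-span⁻ y (z ∷ zs) p∈
  ... | t ∷ v , refl = Λ-affine-zero t (x∈B _ (∈-span⁺ y zs v)) Λz (x∈B y (base∈span y zs))

  -- Affine independence of `y` and `zs`, stated as injectivity of the coefficient map, the form
  -- that `injective⇒dim≤` consumes.
  Independent : Point → ∀ {k} → Vec Point k → Set
  Independent y zs = ∀ {v w} → combination y zs v ≡ combination y zs w → v ≡ w

  -- Given two equal combinations, equal coefficients at `z` cancel and leave a relation among the
  -- old generators; different ones would place `z` in the old span by `affine-solve`.
  independent-extend : ∀ y z {k} (zs : Vec Point k) → Independent y zs → ¬ (z ∈ span y zs) →
                       Independent y (z ∷ zs)
  independent-extend y z zs indep z∉ {t ∷ v} {s ∷ w} eq with t ≟ s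
  ... | yes refl = cong (t ∷_) (indep (cong₂ _,_
          (affine-cancelᵥ t _ _ (proj₁ z) (proj₁ y) (cong proj₁ eq))
          (affine-cancel t _ _ (proj₂ z) (proj₂ y) (cong proj₂ eq))))
  ... | no t≢s = ⊥-elim (z∉ (subst (_∈ span y zs) (sym z≡)
          (IsAffineSubspace.closed (span-affine y zs) ((t ⊝ s) ⁻¹) (base∈span y zs) (∈-span⁺ y zs w) (∈-span⁺ y zs v))))
    where
    z≡ : z ≡ y +ₚ (t ⊝ s) ⁻¹ *ₚ (combination y zs w -ₚ combination y zs v)
    z≡ = cong₂ _,_ (affine-solveᵥ t≢s _ _ (proj₁ z) (proj₁ y) (cong proj₁ eq))
                   (affine-solve t≢s _ _ (proj₂ z) (proj₂ y) (cong proj₂ eq))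

  -- A point of B(L) exhibits L as part of the graph of a function 𝔽ᵈ → 𝔽, so that dim L ≤ d.
  independent⇒≤d : ∀ y {k} (zs : Vec Point k) → Independent y zs → ∃[ x ] x ∈B span y zs → k ≤ d
  independent⇒≤d y zs indep (x , x∈B) =
    injective⇒dim≤ (λ v → proj₁ (combination y zs v)) (λ {v} {w} eq →
      indep (cong₂ _,_ eq (Λ-zero-unique x _ (x∈B _ (∈-span⁺ y zs v))
        (subst (λ u → Λ x (u , proj₂ (combination y zs w)) ≡ 0#) (sym eq) (x∈B _ (∈-span⁺ y zs w))))))

-- Incidence counts

module IncidenceBounds {q d : ℕ} (𝔽 : FiniteField q) (𝑸 : QuadraticForm 𝔽 d)
  (2≢0 : FiniteField._⊕_ 𝔽 (FiniteField.1# 𝔽) (FiniteField.1# 𝔽) ≢ FiniteField.0# 𝔽) where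
  open FiniteField 𝔽
  open Spheres 𝔽 𝑸
  open SphereProperties 𝔽 𝑸

  misses : FinSet V → Sphere → ℕ
  misses P S = ∑ (elements P) (λ x → indicator (¬? (x ∈ₛ? S)))

  nonIncidences : FinSet V → FinSet Sphere → ℕ
  nonIncidences P 𝒮 = ∑ (elements 𝒮) (misses P)

  incidences+nonIncidences : ∀ P 𝒮 → incidences P 𝒮 + nonIncidences P 𝒮 ≡ ∣ P ∣ * ∣ 𝒮 ∣
  incidences+nonIncidences P 𝒮 = begin
    incidences P 𝒮 + nonIncidences P 𝒮
      ≡⟨ cong₂ _+_ (trans (length-filter≡∑ (λ (x , S) → x ∈ₛ? S) (cartesianProduct ps ss)) (∑-cartesianProduct _ ps ss))
           (sym (∑-swap (λ x S → indicator (¬? (x ∈ₛ? S))) ps ss)) ⟩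
    ∑ ps (λ x → ∑ ss (λ S → indicator (x ∈ₛ? S))) + ∑ ps (λ x → ∑ ss (λ S → indicator (¬? (x ∈ₛ? S))))
      ≡⟨ ∑-distrib-+ _ _ ps ⟨
    ∑ ps (λ x → ∑ ss (λ S → indicator (x ∈ₛ? S)) + ∑ ss (λ S → indicator (¬? (x ∈ₛ? S))))
      ≡⟨ ∑-cong ps (λ x → trans (sym (∑-distrib-+ _ _ ss))
           (trans (∑-cong ss (λ S → indicator-¬? (x ∈ₛ? S))) (trans (∑-const 1 ss) (ℕ.*-identityʳ _)))) ⟩
    ∑ ps (λ _ → length ss)
      ≡⟨ ∑-const (length ss) ps ⟩
    ∣ P ∣ * ∣ 𝒮 ∣ ∎
    where
    open ≡-Reasoning
    ps = elements P
    ss = elements 𝒮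

  ∣P∖B∣≡∑ : ∀ P L → ∣P∖B∣ P L ≡ ∑ (elements P) (λ x → indicator (¬? (x ∈B? L)))
  ∣P∖B∣≡∑ P L = length-filter≡∑ (λ x → ¬? (x ∈B? L)) (elements P)

  ∣𝒮∖𝒮∣≡∑ : ∀ 𝒮 L → ∣𝒮∖𝒮∣ 𝒮 L ≡ ∑ (elements 𝒮) (λ S → indicator (¬? (S ∈𝒮? L)))
  ∣𝒮∖𝒮∣≡∑ 𝒮 L = length-filter≡∑ (λ S → ¬? (S ∈𝒮? L)) (elements 𝒮)

  -- The bound of `μ` by the deviation, multiplied by |P||𝒮|: each non-incident pair is charged to
  -- its point or to its sphere.
  nonIncidences-bound : ∀ P 𝒮 L → nonIncidences P 𝒮 ≤ ∣P∖B∣ P L * ∣ 𝒮 ∣ + ∣𝒮∖𝒮∣ 𝒮 L * ∣ P ∣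
  nonIncidences-bound P 𝒮 L = begin
    ∑ ss (misses P)
      ≤⟨ ∑-mono ss (λ {S} _ → ∑-mono ps (λ {x} _ → pointwise x S)) ⟩
    ∑ ss (λ S → ∑ ps (λ x → indicator (¬? (x ∈B? L)) + indicator (¬? (S ∈𝒮? L))))
      ≡⟨ ∑-cong ss (λ S → trans (∑-distrib-+ _ _ ps) (cong₂ _+_ (sym (∣P∖B∣≡∑ P L)) (∑-const _ ps))) ⟩
    ∑ ss (λ S → ∣P∖B∣ P L + ∣ P ∣ * indicator (¬? (S ∈𝒮? L)))
      ≡⟨ ∑-distrib-+ _ _ ss ⟩
    ∑ ss (λ S → ∣P∖B∣ P L) + ∑ ss (λ S → ∣ P ∣ * indicator (¬? (S ∈𝒮? L)))
      ≡⟨ cong₂ _+_ (trans (∑-const _ ss) (ℕ.*-comm ∣ 𝒮 ∣ _))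
           (trans (∑-*ˡ ∣ P ∣ _ ss) (trans (cong (∣ P ∣ *_) (sym (∣𝒮∖𝒮∣≡∑ 𝒮 L))) (ℕ.*-comm ∣ P ∣ _))) ⟩
    ∣P∖B∣ P L * ∣ 𝒮 ∣ + ∣𝒮∖𝒮∣ 𝒮 L * ∣ P ∣ ∎
    where
    open ℕ.≤-Reasoning
    ps = elements P
    ss = elements 𝒮
    pointwise : ∀ x S → indicator (¬? (x ∈ₛ? S)) ≤ indicator (¬? (x ∈B? L)) + indicator (¬? (S ∈𝒮? L))
    pointwise x S = indicator-¬?-union (x ∈ₛ? S) (x ∈B? L) (S ∈𝒮? L)
      (λ x∈B S∈L → Λ⇒∈ₛ 2≢0 S (x∈B (Φ S) S∈L))

  ∃∈B : ∀ P L → ∣P∖B∣ P L < ∣ P ∣ → ∃[ x ] x ∈B L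
  ∃∈B P L few with any? (_∈B? L) (elements P)
  ... | yes some = let x , _ , x∈B = find some in x , x∈B
  ... | no none  = ⊥-elim (ℕ.<-irrefl
    (cong length (List.filter-all (λ x → ¬? (x ∈B? L)) (All.¬Any⇒All¬ (elements P) none))) few)

  ∣P∖B∣-singleton : ∀ P S → ∣P∖B∣ P (span (Φ S) []) ≤ misses P S
  ∣P∖B∣-singleton P S = subst (_≤ misses P S) (sym (∣P∖B∣≡∑ P _)) (∑-mono (elements P) (λ {x} _ →
    indicator-¬?-antimono (x ∈B? _) (x ∈ₛ? S) (λ { x∈S _ (here refl) → ∈ₛ⇒Λ 2≢0 S x∈S })))

  -- Adjoining one generator loses at most the points of `P` off the corresponding sphere.
  ∣P∖B∣-extend : ∀ P S y {k} (zs : Vec Point k) →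
                 ∣P∖B∣ P (span y (Φ S ∷ zs)) ≤ misses P S + ∣P∖B∣ P (span y zs)
  ∣P∖B∣-extend P S y zs = begin
    ∣P∖B∣ P (span y (Φ S ∷ zs))
      ≡⟨ ∣P∖B∣≡∑ P _ ⟩
    ∑ (elements P) (λ x → indicator (¬? (x ∈B? span y (Φ S ∷ zs))))
      ≤⟨ ∑-mono (elements P) (λ {x} _ → indicator-¬?-union (x ∈B? _) (x ∈ₛ? S) (x ∈B? _)
           (λ x∈S x∈B → ∈B-extend y (Φ S) zs x∈B (∈ₛ⇒Λ 2≢0 S x∈S))) ⟩
    ∑ (elements P) (λ x → indicator (¬? (x ∈ₛ? S)) + indicator (¬? (x ∈B? span y zs)))
      ≡⟨ ∑-distrib-+ _ _ (elements P) ⟩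
    misses P S + ∑ (elements P) (λ x → indicator (¬? (x ∈B? span y zs)))
      ≡⟨ cong (λ c → misses P S + c) (∣P∖B∣≡∑ P _) ⟨
    misses P S + ∣P∖B∣ P (span y zs) ∎
    where
    open ℕ.≤-Reasoning

  -- Here t = a / b: the d+1 rich spheres generating L miss together at most t |P| points, and by
  -- Markov's inequality at most (d+1) μ |𝒮| / t ≤ t |𝒮| spheres are not rich.
  module Greedy (P : FinSet V) (a b : ℕ) (small : suc (suc d) * a < suc d * b)
                .{{P≢∅ : NonZero ∣ P ∣}} where

    private
      n : ℕ
      n = ∣ P ∣

    -- The fraction of `P` missed is at most t / (d+1), with denominators cleared.
    Rich : Sphere → Set
    Rich S = (suc d * b) * misses P S ≤ a * n

    rich? : ∀ S → Dec (Rich S)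
    rich? S = _ ≤? _

    -- The base point is the lift of a rich sphere too, so k generators come from k+1 rich spheres;
    -- hence the `suc` in the union bound `few`. `B-nonempty` is carried along because it is what
    -- bounds the dimension.
    record RichSpan (y : Point) : Set where
      field
        {dimension}  : ℕ
        generators   : Vec Point dimension
        independent  : Independent y generators
        few          : (suc d * b) * ∣P∖B∣ P (span y generators) ≤ suc dimension * (a * n)
        B-nonempty   : ∃[ x ] x ∈B span y generators

      points : List Point
      points = span y generators

      dimension≤d : dimension ≤ d
      dimension≤d = independent⇒≤d y generators independent B-nonempty

    open RichSpan

    -- At most d+2 rich spheres together miss at most the fraction (d+2) t / (d+1) of `P`, which
    -- `small` keeps below 1. The range is `k ≤ suc d` because a freshly extended span is known to
    -- have dimension at most `d` only after its `B` is shown to be nonempty.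
    few⇒∃∈B : ∀ L {k} → k ≤ suc d → (suc d * b) * ∣P∖B∣ P L ≤ suc k * (a * n) → ∃[ x ] x ∈B L
    few⇒∃∈B L {k} k≤1+d h = ∃∈B P L (ℕ.*-cancelˡ-< (suc d * b) _ _ (begin-strict
      (suc d * b) * ∣P∖B∣ P L   ≤⟨ h ⟩
      suc k * (a * n)           ≤⟨ ℕ.*-monoˡ-≤ (a * n) (s≤s k≤1+d) ⟩
      suc (suc d) * (a * n)     ≡⟨ ℕ.*-assoc (suc (suc d)) a n ⟨
      (suc (suc d) * a) * n     <⟨ ℕ.*-monoˡ-< n small ⟩
      (suc d * b) * n           ∎))
      where open ℕ.≤-Reasoning

    singleton : ∀ S → Rich S → RichSpan (Φ S)
    singleton S rich = record
      { generators  = []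
      ; independent = λ { {[]} {[]} _ → refl }
      ; few         = few₀
      ; B-nonempty  = few⇒∃∈B _ z≤n few₀
      }
      where
      open ℕ.≤-Reasoning
      few₀ : (suc d * b) * ∣P∖B∣ P (span (Φ S) []) ≤ 1 * (a * n)
      few₀ = begin
        (suc d * b) * ∣P∖B∣ P (span (Φ S) [])   ≤⟨ ℕ.*-monoʳ-≤ (suc d * b) (∣P∖B∣-singleton P S) ⟩
        (suc d * b) * misses P S                ≤⟨ rich ⟩
        a * n                                   ≡⟨ ℕ.*-identityˡ (a * n) ⟨
        1 * (a * n)                             ∎

    extend : ∀ {y} S → Rich S → (X : RichSpan y) → ¬ (Φ S ∈ points X) → RichSpan y
    extend {y} S rich X ΦS∉ = record
      { generators  = Φ S ∷ generators X
      ; independent = independent-extend y (Φ S) (generators X) (independent X) ΦS∉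
      ; few         = few₁
      ; B-nonempty  = few⇒∃∈B _ (s≤s (dimension≤d X)) few₁
      }
      where
      open ℕ.≤-Reasoning
      few₁ : (suc d * b) * ∣P∖B∣ P (span y (Φ S ∷ generators X)) ≤ suc (suc (dimension X)) * (a * n)
      few₁ = begin
        (suc d * b) * ∣P∖B∣ P (span y (Φ S ∷ generators X))
          ≤⟨ ℕ.*-monoʳ-≤ (suc d * b) (∣P∖B∣-extend P S y (generators X)) ⟩
        (suc d * b) * (misses P S + ∣P∖B∣ P (points X))
          ≡⟨ ℕ.*-distribˡ-+ (suc d * b) _ _ ⟩
        (suc d * b) * misses P S + (suc d * b) * ∣P∖B∣ P (points X)
          ≤⟨ ℕ.+-mono-≤ rich (few X) ⟩
        suc (suc (dimension X)) * (a * n) ∎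

    -- Spheres whose lifts already lie in the span are skipped, which keeps the generators
    -- independent. The span only grows, so lifts absorbed early remain in the final one.
    saturate : ∀ {y} Ss → All Rich Ss → (X : RichSpan y) →
               Σ[ Y ∈ RichSpan y ] (∀ {p} → p ∈ points X → p ∈ points Y) × (∀ {S} → S ∈ Ss → Φ S ∈ points Y)
    saturate []       []           X = X , (λ p∈ → p∈) , λ ()
    saturate {y} (S ∷ Ss) (rich ∷ richs) X with Φ S ∈? points X
    ... | yes ΦS∈ = let Y , X⊆Y , Ss⊆Y = saturate Ss richs X in
          Y , X⊆Y , λ { (here refl) → X⊆Y ΦS∈ ; (there S∈) → Ss⊆Y S∈ }
    ... | no ΦS∉  = let Y , X⊆Y , Ss⊆Y = saturate Ss richs (extend S rich X ΦS∉) in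
          Y , (λ p∈ → X⊆Y (span-weaken y (Φ S) (generators X) p∈)) ,
          λ { (here refl) → X⊆Y (head∈span y (Φ S) (generators X)) ; (there S∈) → Ss⊆Y S∈ }

    toModel : ∀ {y} → RichSpan y → LinearModel
    toModel {y} X = record
      { L = points X ; isAffine = span-affine y (generators X) ; B-nonempty = B-nonempty X }

    -- A dimension of at most `d` means at most d+1 generating spheres, and this factor cancels the
    -- d+1 in the definition of `Rich`.
    toModel-few : ∀ {y} (X : RichSpan y) → b * ∣P∖B∣ P (points X) ≤ a * n
    toModel-few X = ℕ.*-cancelˡ-≤ (suc d) (begin
      suc d * (b * ∣P∖B∣ P (points X))   ≡⟨ ℕ.*-assoc (suc d) b _ ⟨
      (suc d * b) * ∣P∖B∣ P (points X)   ≤⟨ few X ⟩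
      suc (dimension X) * (a * n)        ≤⟨ ℕ.*-monoˡ-≤ (a * n) (s≤s (dimension≤d X)) ⟩
      suc d * (a * n)                    ∎)
      where open ℕ.≤-Reasoning

    a<b : a < b
    a<b = ℕ.*-cancelˡ-< (suc (suc d)) a b (ℕ.<-≤-trans small (ℕ.*-monoˡ-≤ b (ℕ.n≤1+n (suc d))))

    module _ (𝒮 : FinSet Sphere) .{{𝒮≢∅ : NonZero ∣ 𝒮 ∣}} .{{_ : NonZero a}}
             (dense : suc d * (nonIncidences P 𝒮 * (b * b)) ≤ (a * a) * (n * ∣ 𝒮 ∣)) where

      private
        ss = elements 𝒮
        m = ∣ 𝒮 ∣

      -- Markov's inequality: each poor sphere misses more than t |P| / (d+1) points, while `dense`
      -- bounds all non-incidences by t² |P||𝒮| / (d+1). Dividing by `a * n` leaves the fraction t.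
      poor-bound : b * ∑ ss (λ S → indicator (¬? (rich? S))) ≤ a * m
      poor-bound = ℕ.*-cancelˡ-≤ (a * n) {{ℕ.m*n≢0 a n}} (begin
        (a * n) * (b * #poor)
          ≡⟨ solve 3 (λ x y z → x :* (y :* z) := y :* (x :* z)) refl (a * n) b #poor ⟩
        b * ((a * n) * #poor)
          ≡⟨ cong (b *_) (∑-*ˡ (a * n) _ ss) ⟨
        b * ∑ ss (λ S → (a * n) * indicator (¬? (rich? S)))
          ≤⟨ ℕ.*-monoʳ-≤ b (∑-mono ss (λ {S} _ → *-indicator-¬?-≤ (rich? S) (λ ¬rich → ℕ.<⇒≤ (ℕ.≰⇒> ¬rich)))) ⟩
        b * ∑ ss (λ S → (suc d * b) * misses P S)
          ≡⟨ cong (b *_) (∑-*ˡ (suc d * b) _ ss) ⟩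
        b * ((suc d * b) * nonIncidences P 𝒮)
          ≡⟨ solve 3 (λ x y z → x :* ((y :* x) :* z) := y :* (z :* (x :* x))) refl b (suc d) (nonIncidences P 𝒮) ⟩
        suc d * (nonIncidences P 𝒮 * (b * b))
          ≤⟨ dense ⟩
        (a * a) * (n * m)
          ≡⟨ solve 3 (λ x y z → (x :* x) :* (y :* z) := (x :* y) :* (x :* z)) refl a n m ⟩
        (a * n) * (a * m) ∎)
        where
        open ℕ.≤-Reasoning
        open ℕ.+-*-Solver
        #poor = ∑ ss (λ S → indicator (¬? (rich? S)))

      -- A rich sphere is needed as base point of the span. If all spheres were poor, `poor-bound`
      -- would give `b * m ≤ a * m`, against `a<b`.
      ∃rich : ∃[ S ] Rich S
      ∃rich with any? rich? ss
      ... | yes some = let S , _ , rich = find some in S , rich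
      ... | no none  = ⊥-elim (ℕ.<⇒≱ (ℕ.*-monoˡ-< m a<b) (subst (λ c → b * c ≤ a * m) #poor≡m poor-bound))
        where
        #poor≡m : ∑ ss (λ S → indicator (¬? (rich? S))) ≡ m
        #poor≡m = trans (sym (length-filter≡∑ (λ S → ¬? (rich? S)) ss))
          (cong length (List.filter-all (λ S → ¬? (rich? S)) (All.¬Any⇒All¬ ss none)))

      approximation : ∃[ M ] b * ∣P∖B∣ P (LinearModel.L M) ≤ a * n × b * ∣𝒮∖𝒮∣ 𝒮 (LinearModel.L M) ≤ a * m
      approximation with ∃rich
      ... | S₀ , rich₀ with saturate (filter rich? ss) (All.all-filter rich? ss) (singleton S₀ rich₀)
      ... | Y , _ , rich⊆Y = toModel Y , toModel-few Y , (begin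
        b * ∣𝒮∖𝒮∣ 𝒮 (points Y)                               ≡⟨ cong (b *_) (∣𝒮∖𝒮∣≡∑ 𝒮 (points Y)) ⟩
        b * ∑ ss (λ S → indicator (¬? (S ∈𝒮? points Y)))
          -- All rich spheres of the family were absorbed, so one outside the model is poor.
          ≤⟨ ℕ.*-monoʳ-≤ b (∑-mono ss (λ {S} S∈ → indicator-¬?-antimono (S ∈𝒮? points Y) (rich? S)
            (λ rich → rich⊆Y (∈-filter⁺ rich? S∈ rich)))) ⟩
        b * ∑ ss (λ S → indicator (¬? (rich? S)))             ≤⟨ poor-bound ⟩
        a * m                                                 ∎)
        where
        open ℕ.≤-Reasoning

-- Rational bounds and square roots

-- The reduced numerator and denominator serve as the `a` and `b` of `Greedy`; `a` is nonzero so
-- that `poor-bound` can divide by it.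
positive-fraction : ∀ {t} → 0ℚ <ℚ t → ∃[ a ] ∃[ b ] NonZero a × NonZero b × t ℚ.* ι b ≡ ι a
positive-fraction {t@(mkℚ +[1+ a ] b _)} _ =
  suc a , suc b , _ , _ , trans (cong (ℚ._* ι (suc b)) (sym (ℚ.↥p/↧p≡p t))) (/-*-cancel (suc a) (suc b))
positive-fraction {mkℚ (+ 0) _ _}    0<t = ⊥-elim (ℤ.Positive.pos (ℚ.positive 0<t))
positive-fraction {mkℚ -[1+ _ ] _ _} 0<t = ⊥-elim (ℤ.Positive.pos (ℚ.positive 0<t))

-- Here and below a fraction enters only through an equation such as `f ℚ.* ι n ≡ ι p`, so that
-- comparisons of fractions reduce to comparisons of natural numbers.
fraction-≤ : ∀ {f t} p n a b .{{_ : NonZero n}} .{{_ : NonZero b}} → f ℚ.* ι n ≡ ι p → t ℚ.* ι b ≡ ι a →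
             b * p ≤ a * n → f ℚ.≤ t
fraction-≤ {f} {t} p n a b fn≡p tb≡a bp≤an =
  ℚ.*-cancelʳ-≤-pos (ι n ℚ.* ι b) {{ℚ.pos*pos⇒pos (ι n) {{ι-positive n}} (ι b) {{ι-positive b}}}} (begin
    f ℚ.* (ι n ℚ.* ι b)   ≡⟨ ℚ.*-assoc f (ι n) (ι b) ⟨
    f ℚ.* ι n ℚ.* ι b     ≡⟨ cong (ℚ._* ι b) fn≡p ⟩
    ι p ℚ.* ι b           ≡⟨ ℚ.*-comm (ι p) (ι b) ⟩
    ι b ℚ.* ι p           ≡⟨ ι-* b p ⟨
    ι (b * p)             ≤⟨ ι-mono-≤ bp≤an ⟩
    ι (a * n)             ≡⟨ ι-* a n ⟩
    ι a ℚ.* ι n           ≡⟨ cong (ℚ._* ι n) tb≡a ⟨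
    t ℚ.* ι b ℚ.* ι n     ≡⟨ solve 3 (λ x y z → (x :* y) :* z := x :* (z :* y)) refl t (ι b) (ι n) ⟩
    t ℚ.* (ι n ℚ.* ι b)   ∎)
  where
  open ℚ.≤-Reasoning
  open +-*-Solver

fraction-complement : ∀ {f} k i j → f ℚ.* ι k ≡ ι i → i + j ≡ k → (1ℚ ℚ.- f) ℚ.* ι k ≡ ι j
fraction-complement {f} k i j fk≡i i+j≡k = begin
  (1ℚ ℚ.- f) ℚ.* ι k         ≡⟨ solve 3 (λ o f k → (o :- f) :* k := o :* k :- f :* k) refl 1ℚ f (ι k) ⟩
  1ℚ ℚ.* ι k ℚ.- f ℚ.* ι k   ≡⟨ cong₂ ℚ._-_ (trans (ℚ.*-identityˡ (ι k)) (cong ι (sym i+j≡k))) fk≡i ⟩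
  ι (i + j) ℚ.- ι i          ≡⟨ cong (ℚ._- ι i) (ι-+ i j) ⟩
  ι i ℚ.+ ι j ℚ.- ι i        ≡⟨ solve 2 (λ i j → i :+ j :- i := j) refl (ι i) (ι j) ⟩
  ι j                        ∎
  where
  open ≡-Reasoning
  open +-*-Solver

fraction-sum : ∀ {f g} n m x y → f ℚ.* ι n ≡ ι x → g ℚ.* ι m ≡ ι y →
               (f ℚ.+ g) ℚ.* ι (n * m) ≡ ι (x * m + y * n)
fraction-sum {f} {g} n m x y fn≡x gm≡y = begin
  (f ℚ.+ g) ℚ.* ι (n * m)                     ≡⟨ cong ((f ℚ.+ g) ℚ.*_) (ι-* n m) ⟩
  (f ℚ.+ g) ℚ.* (ι n ℚ.* ι m)
    ≡⟨ solve 4 (λ f g n m → (f :+ g) :* (n :* m) := f :* n :* m :+ g :* m :* n) refl f g (ι n) (ι m) ⟩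
  f ℚ.* ι n ℚ.* ι m ℚ.+ g ℚ.* ι m ℚ.* ι n     ≡⟨ cong₂ (λ x y → x ℚ.* ι m ℚ.+ y ℚ.* ι n) fn≡x gm≡y ⟩
  ι x ℚ.* ι m ℚ.+ ι y ℚ.* ι n                 ≡⟨ cong₂ ℚ._+_ (ι-* x m) (ι-* y n) ⟨
  ι (x * m) ℚ.+ ι (y * n)                     ≡⟨ ι-+ (x * m) (y * n) ⟨
  ι (x * m + y * n)                           ∎
  where
  open ≡-Reasoning
  open +-*-Solver

fraction-<⇒ : ∀ {t} a b c d .{{_ : NonZero b}} → t ℚ.* ι b ≡ ι a → ι c ℚ.* t <ℚ ι d → suc (c * a) ≤ d * b
fraction-<⇒ {t} a b c d tb≡a ct<d = ι-cancel-< (begin-strict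
  ι (c * a)                ≡⟨ ι-* c a ⟩
  ι c ℚ.* ι a              ≡⟨ cong (ι c ℚ.*_) tb≡a ⟨
  ι c ℚ.* (t ℚ.* ι b)      ≡⟨ ℚ.*-assoc (ι c) t (ι b) ⟨
  ι c ℚ.* t ℚ.* ι b        <⟨ ℚ.*-monoˡ-<-pos (ι b) {{ι-positive b}} ct<d ⟩
  ι d ℚ.* ι b              ≡⟨ ι-* d b ⟨
  ι (d * b)                ∎)
  where open ℚ.≤-Reasoning

fraction-square-≤⇒ : ∀ {t p} a b d k j → t ℚ.* ι b ≡ ι a → p ℚ.* ι k ≡ ι j → ι d ℚ.* p ℚ.≤ t ℚ.* t →
                     d * (j * (b * b)) ≤ (a * a) * k
fraction-square-≤⇒ {t} {p} a b d k j tb≡a pk≡j dp≤t² = ι-cancel-≤ (begin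
  ι (d * (j * (b * b)))
    ≡⟨ trans (ι-* d _) (cong (ι d ℚ.*_) (trans (ι-* j _) (cong (ι j ℚ.*_) (ι-* b b)))) ⟩
  ι d ℚ.* (ι j ℚ.* (ι b ℚ.* ι b))           ≡⟨ cong (λ z → ι d ℚ.* (z ℚ.* (ι b ℚ.* ι b))) pk≡j ⟨
  ι d ℚ.* (p ℚ.* ι k ℚ.* (ι b ℚ.* ι b))
    ≡⟨ solve 4 (λ d p k b → d :* (p :* k :* (b :* b)) := d :* p :* (b :* b :* k)) refl (ι d) p (ι k) (ι b) ⟩
  ι d ℚ.* p ℚ.* (ι b ℚ.* ι b ℚ.* ι k)       ≤⟨ ℚ.*-monoʳ-≤-nonNeg _ {{scale-nonNegative}} dp≤t² ⟩
  t ℚ.* t ℚ.* (ι b ℚ.* ι b ℚ.* ι k)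
    ≡⟨ solve 3 (λ t b k → t :* t :* (b :* b :* k) := (t :* b) :* (t :* b) :* k) refl t (ι b) (ι k) ⟩
  (t ℚ.* ι b) ℚ.* (t ℚ.* ι b) ℚ.* ι k       ≡⟨ cong (λ z → z ℚ.* z ℚ.* ι k) tb≡a ⟩
  ι a ℚ.* ι a ℚ.* ι k                       ≡⟨ trans (ι-* (a * a) k) (cong (ℚ._* ι k) (ι-* a a)) ⟨
  ι ((a * a) * k)                           ∎)
  where
  open ℚ.≤-Reasoning
  open +-*-Solver
  scale-nonNegative : ℚ.NonNegative (ι b ℚ.* ι b ℚ.* ι k)
  scale-nonNegative = subst ℚ.NonNegative (trans (ι-* (b * b) k) (cong (ℚ._* ι k) (ι-* b b))) (ι-nonNegative (b * b * k))

square-mono-≤ : ∀ {r s} → 0ℚ ℚ.≤ r → r ℚ.≤ s → r ℚ.* r ℚ.≤ s ℚ.* s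
square-mono-≤ {r} {s} 0≤r r≤s = ℚ.≤-trans
  (ℚ.*-monoˡ-≤-nonNeg r {{ℚ.nonNegative 0≤r}} r≤s)
  (ℚ.*-monoʳ-≤-nonNeg s {{ℚ.nonNegative (ℚ.≤-trans 0≤r r≤s)}} r≤s)

threshold : ℕ → ℚ
threshold d = (+ suc d / (suc (suc d) ^ 2)) {{ℕ.m^n≢0 (suc (suc d)) 2}}

-- (d+1) · (d+1)/(d+2)² is the square of the rational (d+1)/(d+2).
∃-below-root : ∀ d p → p <ℚ threshold d →
               ∃[ t ] 0ℚ <ℚ t × ι (suc (suc d)) ℚ.* t <ℚ ι (suc d) × ι (suc d) ℚ.* p ℚ.≤ t ℚ.* t
∃-below-root d p p<threshold =
  -- h = (d+1)/(d+2) lies in the upper cut of √((d+1)p), and openness of that cut yields a smaller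
  -- rational still above the root.
  let t , t<h , 0<t , Dp<t² = upper-open (√ (fromℚ (ι (suc d) ℚ.* p))) (0<h , Dp<h²)
  in t , 0<t , subst (ι E ℚ.* t <ℚ_) Eh≡D (ℚ.*-monoʳ-<-pos (ι E) {{ι-positive E}} t<h) , ℚ.<⇒≤ Dp<t²
  where
  open +-*-Solver
  E = suc (suc d)
  instance
    E-positive : ℚ.Positive (ι E)
    E-positive = ι-positive E
  h = + suc d / E
  0<h : 0ℚ <ℚ h
  0<h = ℚ.positive⁻¹ h {{ℚ.normalize-pos (suc d) E}}
  Eh≡D : ι E ℚ.* h ≡ ι (suc d)
  Eh≡D = trans (ℚ.*-comm (ι E) h) (/-*-cancel (suc d) E)
  E²≡ : ι (E ^ 2) ≡ ι E ℚ.* ι E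
  E²≡ = trans (cong (λ k → ι (E * k)) (ℕ.*-identityʳ E)) (ι-* E E)
  pE²<D : p ℚ.* (ι E ℚ.* ι E) <ℚ ι (suc d)
  pE²<D = subst₂ _<ℚ_ (cong (p ℚ.*_) E²≡) (/-*-cancel (suc d) (E ^ 2) {{ℕ.m^n≢0 E 2}})
    (ℚ.*-monoˡ-<-pos (ι (E ^ 2)) {{ι-positive (E ^ 2) {{ℕ.m^n≢0 E 2}}}} p<threshold)
  Dp<h² : ι (suc d) ℚ.* p <ℚ h ℚ.* h
  Dp<h² = ℚ.*-cancelʳ-<-nonNeg (ι E ℚ.* ι E) {{ℚ.pos⇒nonNeg (ι E ℚ.* ι E) {{ℚ.pos*pos⇒pos (ι E) (ι E)}}}} (begin-strict
    ι (suc d) ℚ.* p ℚ.* (ι E ℚ.* ι E)       ≡⟨ ℚ.*-assoc (ι (suc d)) p _ ⟩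
    ι (suc d) ℚ.* (p ℚ.* (ι E ℚ.* ι E))     <⟨ ℚ.*-monoʳ-<-pos (ι (suc d)) {{ι-positive (suc d)}} pE²<D ⟩
    ι (suc d) ℚ.* ι (suc d)                 ≡⟨ cong₂ ℚ._*_ Eh≡D Eh≡D ⟨
    (ι E ℚ.* h) ℚ.* (ι E ℚ.* h)
      ≡⟨ solve 2 (λ e h → (e :* h) :* (e :* h) := (h :* h) :* (e :* e)) refl (ι E) h ⟩
    h ℚ.* h ℚ.* (ι E ℚ.* ι E)               ∎)
    where open ℚ.≤-Reasoning

-- The passage from rational `t` to the real square root, for any family `f` that has a value at
-- most 2t for every admissible `t`; below, `f` is the deviation and `p` is `μ`.
module _ {I : Set} {f : I → ℚ} (d : ℕ) {p : ℚ} (p<threshold : p <ℚ threshold d)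
         (∃small : ∀ t → 0ℚ <ℚ t → ι (suc (suc d)) ℚ.* t <ℚ ι (suc d) → ι (suc d) ℚ.* p ℚ.≤ t ℚ.* t →
                   ∃[ i ] f i ℚ.≤ t ℚ.+ t) where

  private
    D : ℚ
    D = + suc d / 1
    instance
      D-positive : ℚ.Positive D
      D-positive = ℚ.normalize-pos (suc d) 1
      D-nonZero : ℚ.NonZero D
      D-nonZero = ℚ.pos⇒nonZero D

  -- If h² ≥ (d+1) p, then t can be taken to be the minimum of t₀ and a rational between h and k.
  lower-bound<2√ : ∀ {h k} → 0ℚ ℚ.≤ h → h <ℚ k → p ℚ.≤ h ℚ.* h ℚ.* (ℚ.1/ D) → ∃[ i ] f i <ℚ k ℚ.+ k
  lower-bound<2√ {h} {k} 0≤h h<k p≤h²/D = below (∃-below-root d p p<threshold) (ℚ.<-dense h<k)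
    where
    Dp≤h² : ι (suc d) ℚ.* p ℚ.≤ h ℚ.* h
    Dp≤h² = subst₂ ℚ._≤_ (cong (ℚ._* p) (sym (ι≡/1 (suc d))))
      (trans (ℚ.*-comm D _) (trans (ℚ.*-assoc (h ℚ.* h) (ℚ.1/ D) D)
        (trans (cong (h ℚ.* h ℚ.*_) (ℚ.*-inverseˡ D)) (ℚ.*-identityʳ (h ℚ.* h)))))
      (ℚ.*-monoˡ-≤-nonNeg D {{ℚ.pos⇒nonNeg D}} p≤h²/D)
    below-k : ∀ {t} → t <ℚ k → ∃[ i ] f i ℚ.≤ t ℚ.+ t → ∃[ i ] f i <ℚ k ℚ.+ k
    below-k t<k (i , fi≤2t) = i , ℚ.≤-<-trans fi≤2t (ℚ.+-mono-< t<k t<k)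
    below : ∃[ t ] 0ℚ <ℚ t × ι (suc (suc d)) ℚ.* t <ℚ ι (suc d) × ι (suc d) ℚ.* p ℚ.≤ t ℚ.* t →
            ∃[ u ] h <ℚ u × u <ℚ k → ∃[ i ] f i <ℚ k ℚ.+ k
    below (t₀ , 0<t₀ , small , Dp≤t₀²) (u , h<u , u<k) with u ℚ.≤? t₀
    ... | yes u≤t₀ = below-k u<k (∃small u (ℚ.≤-<-trans 0≤h h<u)
            (ℚ.≤-<-trans (ℚ.*-monoˡ-≤-nonNeg (ι (suc (suc d))) {{ι-nonNegative (suc (suc d))}} u≤t₀) small)
            (ℚ.≤-trans Dp≤h² (square-mono-≤ 0≤h (ℚ.<⇒≤ h<u))))
    ... | no u≰t₀  = below-k (ℚ.<-trans (ℚ.≰⇒> u≰t₀) u<k) (∃small t₀ 0<t₀ small Dp≤t₀²)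

  lower-2√ : ∀ {r s} → r <ℚ s → (∀ i → s ℚ.≤ f i) → lower (2 · √ (suc d · fromℚ p)) r
  -- The lower cut unfolds to a disjunction of decidable rational comparisons. If both fail,
  -- `lower-bound<2√` between r/2 and s/2 gives a value of `f` below the lower bound `s`.
  lower-2√ {r} {s} r<s s≤f = decide (r ℚ.* ½ ℚ.<? 0ℚ) ((r ℚ.* ½) ℚ.* (r ℚ.* ½) ℚ.* (ℚ.1/ D) ℚ.<? p)
    where
    s/2+s/2≡s : s ℚ.* ½ ℚ.+ s ℚ.* ½ ≡ s
    s/2+s/2≡s = trans (sym (ℚ.*-distribˡ-+ s ½ ½)) (ℚ.*-identityʳ s)
    decide : Dec (r ℚ.* ½ <ℚ 0ℚ) → Dec ((r ℚ.* ½) ℚ.* (r ℚ.* ½) ℚ.* (ℚ.1/ D) <ℚ p) →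
             (r ℚ.* ½ <ℚ 0ℚ) ⊎ ((r ℚ.* ½) ℚ.* (r ℚ.* ½) ℚ.* (ℚ.1/ D) <ℚ p)
    decide (yes r/2<0) _        = inj₁ r/2<0
    decide (no _)      (yes lt) = inj₂ lt
    decide (no r/2≮0)  (no ≮p)  =
      let i , fi<s = lower-bound<2√ (ℚ.≮⇒≥ r/2≮0) (ℚ.*-monoˡ-<-pos ½ r<s) (ℚ.≮⇒≥ ≮p)
      in ⊥-elim (ℚ.<-irrefl refl (ℚ.≤-<-trans (s≤f i) (subst (f i <ℚ_) s/2+s/2≡s fi<s)))

-- The distance bounds in terms of `μ`.

module Distance {q d : ℕ} (𝔽 : FiniteField q) (𝑸 : QuadraticForm 𝔽 d)
  (2≢0 : FiniteField._⊕_ 𝔽 (FiniteField.1# 𝔽) (FiniteField.1# 𝔽) ≢ FiniteField.0# 𝔽)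
  (P : FinSet (Spheres.V 𝔽 𝑸)) (𝒮 : FinSet (Spheres.Sphere 𝔽 𝑸))
  .{{P≢∅ : NonZero ∣ P ∣}} .{{𝒮≢∅ : NonZero ∣ 𝒮 ∣}} where

  open Spheres 𝔽 𝑸
  open IncidenceBounds 𝔽 𝑸 2≢0

  private
    n m N : ℕ
    n = ∣ P ∣
    m = ∣ 𝒮 ∣
    N = nonIncidences P 𝒮
    instance
      nm≢0 : NonZero (n * m)
      nm≢0 = ℕ.m*n≢0 n m
      nm-positive : ℚ.Positive (ι (n * m))
      nm-positive = ι-positive (n * m)
    dev : LinearModel → ℚ
    dev M = deviation P 𝒮 (LinearModel.L M)

  μ-*-nm : μ P 𝒮 ℚ.* ι (n * m) ≡ ι N
  μ-*-nm = fraction-complement {+ incidences P 𝒮 / (n * m)} (n * m) (incidences P 𝒮) N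
    (/-*-cancel (incidences P 𝒮) (n * m)) (incidences+nonIncidences P 𝒮)

  deviation-*-nm : ∀ L → deviation P 𝒮 L ℚ.* ι (n * m) ≡ ι (∣P∖B∣ P L * m + ∣𝒮∖𝒮∣ 𝒮 L * n)
  deviation-*-nm L = fraction-sum {+ ∣P∖B∣ P L / n} {+ ∣𝒮∖𝒮∣ 𝒮 L / m} n m (∣P∖B∣ P L) (∣𝒮∖𝒮∣ 𝒮 L)
    (/-*-cancel _ n) (/-*-cancel _ m)

  μ≤deviation : ∀ L → μ P 𝒮 ℚ.≤ deviation P 𝒮 L
  μ≤deviation L = ℚ.*-cancelʳ-≤-pos (ι (n * m))
    (subst₂ ℚ._≤_ (sym μ-*-nm) (sym (deviation-*-nm L)) (ι-mono-≤ (nonIncidences-bound P 𝒮 L)))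

  -- `μ P 𝒮` is itself the rational lower bound that the lower cut of the infimum asks for.
  μ≤dist-lin : fromℚ (μ P 𝒮) ≤ℝ dist-lin P 𝒮
  μ≤dist-lin r r<μ = μ P 𝒮 , r<μ , λ M → μ≤deviation (LinearModel.L M)

  ∃model : ∀ t → 0ℚ <ℚ t → ι (suc (suc d)) ℚ.* t <ℚ ι (suc d) →
           ι (suc d) ℚ.* μ P 𝒮 ℚ.≤ t ℚ.* t → ∃[ M ] dev M ℚ.≤ t ℚ.+ t
  ∃model t 0<t small dense =
    let a , b , a≢0 , b≢0 , tb≡a = positive-fraction 0<t
    in fromFraction a b {{a≢0}} {{b≢0}} tb≡a
    where
    fromFraction : ∀ a b .{{_ : NonZero a}} .{{_ : NonZero b}} → t ℚ.* ι b ≡ ι a → ∃[ M ] dev M ℚ.≤ t ℚ.+ t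
    fromFraction a b tb≡a =
      let M , few , fewer = approximation 𝒮 (fraction-square-≤⇒ {t} {μ P 𝒮} a b (suc d) (n * m) N tb≡a μ-*-nm dense)
      in M , ℚ.+-mono-≤
        (fraction-≤ {+ ∣P∖B∣ P (LinearModel.L M) / n} {t} _ n a b (/-*-cancel _ n) tb≡a few)
        (fraction-≤ {+ ∣𝒮∖𝒮∣ 𝒮 (LinearModel.L M) / m} {t} _ m a b (/-*-cancel _ m) tb≡a fewer)
      where open Greedy P a b (fraction-<⇒ {t} a b (suc (suc d)) (suc d) tb≡a small)

  dist-lin≤2√μ : μ P 𝒮 <ℚ threshold d → dist-lin P 𝒮 ≤ℝ 2 · √ (suc d · fromℚ (μ P 𝒮))
  dist-lin≤2√μ μ<threshold r (s , r<s , s≤dev) = lower-2√ {f = dev} d {μ P 𝒮} μ<threshold ∃model r<s s≤dev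

-- From the excess `σ` to `μ`.

*-1/-cancel : ∀ x c .{{_ : ℚ.NonZero c}} → x ℚ.* c ℚ.* (ℚ.1/ c) ≡ x
*-1/-cancel x c = trans (ℚ.*-assoc x c (ℚ.1/ c)) (trans (cong (x ℚ.*_) (ℚ.*-inverseʳ c)) (ℚ.*-identityʳ x))

-- For r < r′ < p, locatedness places η above r/c, as wanted, or below r′/c. In the second case nm(c
-- - r′) is in the lower cut of nmc(1 - η), hence below `s`, and `bound` gives p ≤ r′, a
-- contradiction.
≤-⊙-from-complement : ∀ n m c .{{_ : NonZero n}} .{{_ : NonZero m}} .{{_ : ℚ.Positive c}} η {p s} →
  (∀ r → (c ℚ.- r) ℚ.* ι m ℚ.* ι n <ℚ s → p ℚ.≤ r) →
  (n · m · c ⊙ (1ℚ ⊖ η)) ≤ℝ fromℚ s → fromℚ p ≤ℝ c ⊙ η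
≤-⊙-from-complement n m c η {p} {s} bound hyp r r<p =
  let r′ , r<r′ , r′<p = ℚ.<-dense r<p
  in lowerOr r′ r′<p (located η (ℚ.*-monoˡ-<-pos c⁻¹ {{ℚ.1/pos⇒pos c}} r<r′))
  where
  open +-*-Solver
  M = + m / 1
  N = + n / 1
  instance
    c-nonZero : ℚ.NonZero c
    c-nonZero = ℚ.pos⇒nonZero c
    M-nonZero : ℚ.NonZero M
    M-nonZero = ℚ.pos⇒nonZero M {{ℚ.normalize-pos m 1}}
    N-nonZero : ℚ.NonZero N
    N-nonZero = ℚ.pos⇒nonZero N {{ℚ.normalize-pos n 1}}
  c⁻¹ = ℚ.1/ c
  -- The argument at which the nested cut consults η: divide by `N`, `M` and `c` in turn, then
  -- subtract from 1.
  scaled : ∀ x → 1ℚ ℚ.- ((c ℚ.- x) ℚ.* M ℚ.* N) ℚ.* (ℚ.1/ N) ℚ.* (ℚ.1/ M) ℚ.* c⁻¹ ≡ x ℚ.* c⁻¹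
  scaled x = begin
    1ℚ ℚ.- ((c ℚ.- x) ℚ.* M ℚ.* N) ℚ.* (ℚ.1/ N) ℚ.* (ℚ.1/ M) ℚ.* c⁻¹
      ≡⟨ cong (λ z → 1ℚ ℚ.- z ℚ.* c⁻¹)
           (trans (cong (ℚ._* (ℚ.1/ M)) (*-1/-cancel ((c ℚ.- x) ℚ.* M) N)) (*-1/-cancel (c ℚ.- x) M)) ⟩
    1ℚ ℚ.- (c ℚ.- x) ℚ.* c⁻¹
      ≡⟨ solve 4 (λ o c x i → o :- (c :- x) :* i := o :- c :* i :+ x :* i) refl 1ℚ c x c⁻¹ ⟩
    1ℚ ℚ.- c ℚ.* c⁻¹ ℚ.+ x ℚ.* c⁻¹
      ≡⟨ cong (λ z → 1ℚ ℚ.- z ℚ.+ x ℚ.* c⁻¹) (ℚ.*-inverseʳ c) ⟩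
    0ℚ ℚ.+ x ℚ.* c⁻¹
      ≡⟨ ℚ.+-identityˡ (x ℚ.* c⁻¹) ⟩
    x ℚ.* c⁻¹ ∎
    where open ≡-Reasoning
  lowerOr : ∀ x → x <ℚ p → lower η (r ℚ.* c⁻¹) ⊎ upper η (x ℚ.* c⁻¹) → lower η (r ℚ.* c⁻¹)
  lowerOr x x<p (inj₁ l) = l
  lowerOr x x<p (inj₂ u) = ⊥-elim (ℚ.<-irrefl refl (ℚ.≤-<-trans (bound x below) x<p))
    where
    below : (c ℚ.- x) ℚ.* ι m ℚ.* ι n <ℚ s
    below = subst₂ (λ i j → (c ℚ.- x) ℚ.* i ℚ.* j <ℚ s) (sym (ι≡/1 m)) (sym (ι≡/1 n))
      (hyp _ (subst (upper η) (sym (scaled x)) u))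

/≡*1/ : ∀ k q .{{_ : NonZero q}} → + k / q ≡ ι k ℚ.* (+ 1 / q)
/≡*1/ k q = begin
  + k / q                            ≡⟨ ℚ.*-identityʳ (+ k / q) ⟨
  (+ k / q) ℚ.* 1ℚ                   ≡⟨ cong ((+ k / q) ℚ.*_) (trans (/-*-cancel 1 q) (ι≡/1 1)) ⟨
  (+ k / q) ℚ.* ((+ 1 / q) ℚ.* ι q)
    ≡⟨ solve 3 (λ x y z → x :* (y :* z) := x :* z :* y) refl (+ k / q) (+ 1 / q) (ι q) ⟩
  (+ k / q) ℚ.* ι q ℚ.* (+ 1 / q)    ≡⟨ cong (ℚ._* (+ 1 / q)) (/-*-cancel k q) ⟩
  ι k ℚ.* (+ 1 / q)                  ∎
  where
  open ≡-Reasoning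
  open +-*-Solver

-- Applied with e = 1/q, K = |P||𝒮| and i the incidence count. The terms in `K ℚ.* e` cancel,
-- leaving K - i < r K, and K - i is p K.
deficit-≤ : ∀ {e p r K i} .{{_ : ℚ.Positive K}} → p ℚ.* K ℚ.+ i ≡ K →
            (1ℚ ℚ.- e ℚ.- r) ℚ.* K <ℚ i ℚ.- K ℚ.* e → p ℚ.≤ r
deficit-≤ {e} {p} {r} {K} {i} pK+i≡K h = ℚ.*-cancelʳ-≤-pos K (begin
  p ℚ.* K                                   ≡⟨ solve 2 (λ x i → x := x :+ i :- i) refl (p ℚ.* K) i ⟩
  p ℚ.* K ℚ.+ i ℚ.- i                       ≡⟨ cong (ℚ._- i) (trans pK+i≡K (sym (ℚ.*-identityˡ K))) ⟩
  1ℚ ℚ.* K ℚ.- i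
    ≡⟨ solve 5 (λ o e r k i → o :* k :- i := (o :- e :- r) :* k :+ (r :* k :+ k :* e :- i)) refl 1ℚ e r K i ⟩
  (1ℚ ℚ.- e ℚ.- r) ℚ.* K ℚ.+ w              ≤⟨ ℚ.+-monoˡ-≤ w (ℚ.<⇒≤ h) ⟩
  i ℚ.- K ℚ.* e ℚ.+ w
    ≡⟨ solve 4 (λ e r k i → i :- k :* e :+ (r :* k :+ k :* e :- i) := r :* k) refl e r K i ⟩
  r ℚ.* K                                   ∎)
  where
  open ℚ.≤-Reasoning
  open +-*-Solver
  w = r ℚ.* K ℚ.+ K ℚ.* e ℚ.- i

2√-mono : ∀ d {x y} → x ≤ℝ y → 2 · √ (suc d · x) ≤ℝ 2 · √ (suc d · y)
2√-mono d x≤y r = map₂ (x≤y _)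

-- Turns the real threshold condition on (1 - 1/q) η into the rational one on `μ` that
-- `dist-lin≤2√μ` expects.
fromℚ≤⇒< : ∀ {p s} x → fromℚ p ≤ℝ x → x <ℝ fromℚ s → p <ℚ s
fromℚ≤⇒< x p≤x (r , x<r , r<s) = ℚ.≤-<-trans (ℚ.≮⇒≥ (λ r<p → disjoint x r (p≤x r r<p , x<r))) r<s

module Excess {q d : ℕ} (𝔽 : FiniteField q) (𝑸 : QuadraticForm 𝔽 d)
  (2≢0 : FiniteField._⊕_ 𝔽 (FiniteField.1# 𝔽) (FiniteField.1# 𝔽) ≢ FiniteField.0# 𝔽)
  (P : FinSet (Spheres.V 𝔽 𝑸)) (𝒮 : FinSet (Spheres.Sphere 𝔽 𝑸))
  .{{P≢∅ : NonZero ∣ P ∣}} .{{𝒮≢∅ : NonZero ∣ 𝒮 ∣}} where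

  open FiniteField 𝔽 using (q-nonZero)
  open Spheres 𝔽 𝑸
  open IncidenceBounds 𝔽 𝑸 2≢0
  open Distance 𝔽 𝑸 2≢0 P 𝒮

  private
    n m I : ℕ
    n = ∣ P ∣
    m = ∣ 𝒮 ∣
    I = incidences P 𝒮

  σ≡ : σ P 𝒮 ≡ ι I ℚ.- ι (n * m) ℚ.* (+ 1 / q)
  σ≡ = cong₂ ℚ._-_ (sym (ι≡/1 I)) (/≡*1/ (n * m) q)

  excess⇒μ≤ : ∀ r → (1-q⁻¹ ℚ.- r) ℚ.* ι m ℚ.* ι n <ℚ σ P 𝒮 → μ P 𝒮 ℚ.≤ r
  excess⇒μ≤ r h = deficit-≤ {+ 1 / q} {μ P 𝒮} {r} {ι (n * m)} {ι I} {{ι-positive (n * m) {{ℕ.m*n≢0 n m}}}}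
    (trans (cong (ℚ._+ ι I) μ-*-nm) (trans (sym (ι-+ (nonIncidences P 𝒮) I))
      (cong ι (trans (ℕ.+-comm _ I) (incidences+nonIncidences P 𝒮)))))
    (subst₂ _<ℚ_ (trans (ℚ.*-assoc (1-q⁻¹ ℚ.- r) (ι m) (ι n))
      (cong ((1-q⁻¹ ℚ.- r) ℚ.*_) (trans (ℚ.*-comm (ι m) (ι n)) (sym (ι-* n m))))) σ≡ h)

  μ≤1-q⁻¹⊙η : ∀ η → (n · m · 1-q⁻¹ ⊙ (1ℚ ⊖ η)) ≤ℝ fromℚ (σ P 𝒮) → fromℚ (μ P 𝒮) ≤ℝ 1-q⁻¹ ⊙ η
  μ≤1-q⁻¹⊙η η = ≤-⊙-from-complement n m 1-q⁻¹ η {μ P 𝒮} {σ P 𝒮} excess⇒μ≤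

corollary2p10 : ∀ (q d : ℕ) → OddPrimePower q → 2 ≤ d →
    (𝔽 : FiniteField q) (𝑸 : QuadraticForm 𝔽 d) → QuadraticForm.Nondegenerate 𝑸 →
    let open Spheres 𝔽 𝑸 in
    (P : FinSet V) (𝒮 : FinSet Sphere) .{{P≢∅ : NonZero ∣ P ∣}} .{{𝒮≢∅ : NonZero ∣ 𝒮 ∣}} →
    let threshold = + (suc d) / (suc (suc d) ^ 2) in
    (fromℚ (μ P 𝒮) ≤ℝ dist-lin P 𝒮)
    × (μ P 𝒮 <ℚ threshold → dist-lin P 𝒮 ≤ℝ 2 · √ (suc d · fromℚ (μ P 𝒮)))
    × (∀ (η : ℝ) →
    (∣ P ∣ · ∣ 𝒮 ∣ · 1-q⁻¹ ⊙ (1ℚ ⊖ η)) ≤ℝ fromℚ (σ P 𝒮) →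
    (fromℚ (μ P 𝒮) ≤ℝ 1-q⁻¹ ⊙ η)
    × (fromℚ 0ℚ <ℝ 1-q⁻¹ ⊙ η → 1-q⁻¹ ⊙ η <ℝ fromℚ threshold →
    dist-lin P 𝒮 ≤ℝ 2 · √ (suc d · 1-q⁻¹ ⊙ η)))
corollary2p10 q d (2∤q , _) _ 𝔽 𝑸 _ P 𝒮 =
  μ≤dist-lin , dist-lin≤2√μ , λ η excess →
    let μ≤y = μ≤1-q⁻¹⊙η η excess
    in μ≤y , λ _ y<threshold r r<dist →
      2√-mono d {fromℚ (μ P 𝒮)} {1-q⁻¹ ⊙ η} μ≤y r
        (dist-lin≤2√μ (fromℚ≤⇒< (1-q⁻¹ ⊙ η) μ≤y y<threshold) r r<dist)
  where
  open Spheres 𝔽 𝑸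
  2≢0 = FieldProperties.2≢0 𝔽 2∤q
  open Distance 𝔽 𝑸 2≢0 P 𝒮
  open Excess 𝔽 𝑸 2≢0 P 𝒮
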